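{- For all $k\ge5$ and $n\ge\binom{k-1}{2}+2$, there are two distinct maximal $C_k$-matroids on $K_n$ (maximal with respect to the weak order).
   Context: $C_k$ is the cycle with $k$ edges. A $C_k$-matroid on $K_n$ is a matroid on $E(K_n)$ in which the edge set of every subgraph isomorphic to $C_k$ is a circuit. Weak order: ${\mathcal M}_1\preceq{\mathcal M}_2$ if every independent set of ${\mathcal M}_1$ is independent in ${\mathcal M}_2$. -}

module Defs where

open import Data.Nat using (ℕ; zero; suc; _<_; _≤_; _∸_; _+_)
open import Data.Nat.DivMod using (_mod_)
open import Data.Fin as F using (Fin; toℕ)
open import Data.Fin.Properties using (_≟_)
open import Data.Bool using (Bool; true; false; _∨_; _∧_)
open import Data.List using (List; []; _∷_; concatMap; filterᵇ; length; allFin)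
open import Data.Product using (Σ; ∃; ∃-syntax; _×_; _,_)
open import Data.Sum using (_⊎_)
open import Relation.Binary.PropositionalEquality using (_≡_)
open import Relation.Nullary using (¬_; yes; no)
open import Relation.Nullary.Decidable using (⌊_⌋)
open import Function.Definitions using (Injective)
open import Function.Bundles using (_⇔_)
open import Level using (Level) renaming (suc to lsuc; zero to lzero)

Edge : ℕ → Set
Edge n = Σ (Fin n) λ i → Σ (Fin n) λ j → i F.< j

ESet : ℕ → Set
ESet n = Edge n → Bool

allEdges : (n : ℕ) → List (Edge n)
allEdges n = concatMap (λ i → concatMap (λ j → pick i j) (allFin n)) (allFin n)
  where
  pick : Fin n → Fin n → List (Edge n)
  pick i j with i F.<? j
  ... | yes p = (i , j , p) ∷ []
  ... | no _  = []

card : ∀ {n} → ESet n → ℕ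
card {n} A = length (filterᵇ A (allEdges n))

_∈ₑ_ : ∀ {n} → Edge n → ESet n → Set
e ∈ₑ A = A e ≡ true

_⊆ₑ_ : ∀ {n} → ESet n → ESet n → Set
A ⊆ₑ B = ∀ e → e ∈ₑ A → e ∈ₑ B

∅ₑ : ∀ {n} → ESet n
∅ₑ _ = false

_==ₑ_ : ∀ {n} → Edge n → Edge n → Bool
(i , j , _) ==ₑ (i' , j' , _) = ⌊ i ≟ i' ⌋ ∧ ⌊ j ≟ j' ⌋

insertₑ : ∀ {n} → Edge n → ESet n → ESet n
insertₑ e A f = A f ∨ (f ==ₑ e)

record Matroid (n : ℕ) : Set₁ where
  field
    Indep       : ESet n → Set
    indep-∅     : Indep ∅ₑ
    indep-⊆     : ∀ A B → A ⊆ₑ B → Indep B → Indep A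
    indep-aug   : ∀ A B → Indep A → Indep B → card A < card B →
                  ∃[ e ] (e ∈ₑ B × ¬ (e ∈ₑ A) × Indep (insertₑ e A))
open Matroid public

IsCircuit : ∀ {n} → Matroid n → ESet n → Set
IsCircuit M C =
  ¬ Indep M C ×
  (∀ D → D ⊆ₑ C → (∃[ e ] (e ∈ₑ C × ¬ (e ∈ₑ D))) → Indep M D)

nextFin : ∀ {k} → Fin k → Fin k
nextFin {suc m} i = suc (toℕ i) mod (suc m)

EndsAt : ∀ {n} → Edge n → Fin n → Fin n → Set
EndsAt (i , j , _) a b = (i ≡ a × j ≡ b) ⊎ (i ≡ b × j ≡ a)

IsCkSet : ∀ {n} → (k : ℕ) → ESet n → Set
IsCkSet {n} k S =
  Σ (Fin k → Fin n) λ v → (Injective _≡_ _≡_ v ×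
          (∀ e → e ∈ₑ S ⇔ (∃[ t ] EndsAt e (v t) (v (nextFin {k} t)))))

IsCkMatroid : ∀ {n} → ℕ → Matroid n → Set
IsCkMatroid k M = ∀ S → IsCkSet k S → IsCircuit M S

_≼_ : ∀ {n} → Matroid n → Matroid n → Set
M₁ ≼ M₂ = ∀ A → Indep M₁ A → Indep M₂ A

IsMaximalCkMatroid : ∀ {n} → ℕ → Matroid n → Set₁
IsMaximalCkMatroid {n} k M =
  IsCkMatroid k M × (∀ (M' : Matroid n) → IsCkMatroid k M' → M ≼ M' → M' ≼ M)

SameMatroid : ∀ {n} → Matroid n → Matroid n → Set
SameMatroid M₁ M₂ = ∀ A → Indep M₁ A ⇔ Indep M₂ A

{-# OPTIONS --safe #-}

-- One maximal matroid is the sparse paving matroid of rank k whose circuit-hyperplanes are the k-cycles.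
-- In any C_k-matroid M above it, a (k-1)-cycle u plus a pendant edge u₁z spans every edge on u ∪ {z}, by
-- completing Hamiltonian paths to k-cycles.  A (k-1)-cycle u plus a chord is independent of the same size k and
-- lies in that span, so it spans all the edges at every z, hence everything, and M has rank k.
-- The other one is any maximal C_k-matroid above the graphic matroid, whose rank n - 1 exceeds k.  It is found
-- by searching the finitely many families of edge sets.
module Submission where

open import Defs
open import Data.Bool using (Bool; true; false; _∨_; _∧_; _xor_; not)
open import Data.Bool.Properties as BP using (∨-zeroʳ; ∨-identityʳ; xor-comm; xor-assoc; xor-same; xor-identityʳ)
open import Data.Empty using (⊥; ⊥-elim)
open import Data.Fin as F using (Fin; zero; suc; toℕ; fromℕ; inject₁; inject≤)
open import Data.Fin.Properties as FP using (_≟_)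
open import Data.Fin.Relation.Unary.Top using (view; ‵fromℕ; ‵inject₁)
open import Data.List using (List; []; _∷_; _++_; concatMap; filterᵇ; length; allFin; foldr; map; tabulate; lookup; filter)
open import Data.List.Membership.Propositional using (_∈_; lose; find)
open import Data.List.Membership.Propositional.Properties using (∈-concatMap⁺; ∈-concatMap⁻; ∈-allFin; ∈-lookup; ∈-++⁺ˡ; ∈-++⁺ʳ; ∈-map⁺; ∈-filter⁺; ∈-filter⁻; ∈-∃++)
open import Data.List.Properties using (tabulate-lookup; length-tabulate; ++-assoc; ++-identityʳ)
open import Data.List.Relation.Binary.Permutation.Propositional using (_↭_; refl; prep; swap; ↭-sym; ↭-trans; ↭-reflexive; ↭⇒↭ₛ)
open import Data.List.Relation.Binary.Permutation.Propositional.Properties using (++-comm; shift; ↭-length; ∈-resp-↭; ∷↭∷ʳ)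
import Data.List.Relation.Binary.Permutation.Setoid.Properties as PermS
open import Data.List.Relation.Unary.All as All using (All; []; _∷_)
import Data.List.Relation.Unary.All.Properties as AllP
open import Data.List.Relation.Unary.AllPairs as AllPairs using ([]; _∷_)
import Data.List.Relation.Unary.AllPairs.Properties as AllPairsP
open import Data.List.Relation.Unary.Any as Any using (Any; here; there)
open import Data.List.Relation.Unary.Unique.Propositional using (Unique)
import Data.List.Relation.Unary.Unique.Propositional.Properties as UniqueP
open import Data.Nat using (ℕ; zero; suc; _≤_; _<_; _∸_; _+_; z≤n; s≤s)
open import Data.Nat.Combinatorics using (_C_; nC1≡n; nCk+nC[k+1]≡[n+1]C[k+1])
open import Data.Nat.DivMod using (_%_; m<n⇒m%n≡m; n%n≡0)
open import Data.Nat.Properties using (≤-trans; ≤-reflexive; n≤1+n; m≤n⇒m≤1+n; <⇒≱; ≮⇒≥; suc-injective; m≤n+m; _<?_; +-mono-≤; +-monoˡ-≤; +-comm; module ≤-Reasoning)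
open import Data.Product as Prod using (Σ; ∃; ∃-syntax; _×_; _,_; proj₁; proj₂)
open import Data.Sum using (_⊎_; inj₁; inj₂)
import Data.Vec.Functional as VF
open import Function using (_∘_; case_of_)
open import Function.Bundles using (_⇔_; mk⇔; Equivalence)
open import Function.Definitions using (Injective)
open import Relation.Binary.Definitions using (tri<; tri≈; tri>)
open import Relation.Binary.PropositionalEquality using (_≡_; _≢_; refl; sym; trans; cong; cong₂; subst; subst₂; module ≡-Reasoning; setoid; _≗_)
open import Relation.Nullary using (¬_; Dec; yes; no; does)
open import Relation.Nullary.Decidable using (⌊_⌋; map′; _×-dec_; _⊎-dec_; _→-dec_; ¬?; decidable-stable)

-- Cycles enter the matroid arguments mostly through parity: a k-cycle has all degrees even, and at
-- most one new edge can make a given set even. So two k-cycles never differ by the exchange of a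
-- single edge, which is what augmentation in the sparse paving matroid needs. A (k-1)-cycle plus an
-- edge is never a k-cycle. And graphic independence becomes the absence of a nonempty even subset,
-- with no forests or components to handle.
--
-- For the sparse paving matroid only the rank is at stake: every C_k-matroid makes the k-cycles
-- dependent, so a matroid above it can gain only sets with more than k edges.
--
-- The independence predicate of a matroid is arbitrary, so the competitors of a candidate for
-- maximality cannot be listed directly. The search runs over families given by lists, and a
-- competitor becomes such a list under a double negation.
--
-- The binomial bound enters as n ≥ k + 2: there is then a path with k + 1 edges, and it tells the
-- two matroids apart.

private variable n : ℕ

-- Pointwise equality of edge sets, and decidable equality of edges

infix 4 _≐_
_≐_ : ESet n → ESet n → Set
A ≐ B = ∀ e → A e ≡ B e

≐-sym : {A B : ESet n} → A ≐ B → B ≐ A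
≐-sym p e = sym (p e)

≐⇒⊆ : {A B : ESet n} → A ≐ B → A ⊆ₑ B
≐⇒⊆ p e q = trans (sym (p e)) q

⊆-antisym : {A B : ESet n} → A ⊆ₑ B → B ⊆ₑ A → A ≐ B
⊆-antisym {A = A} {B} p q e with A e in a | B e in b
... | true  | true  = refl
... | false | false = refl
... | true  | false = trans (sym (p e a)) b
... | false | true  = trans (sym a) (q e b)

≢true⇒≡false : ∀ {b} → ¬ (b ≡ true) → b ≡ false
≢true⇒≡false {true}  p = ⊥-elim (p refl)
≢true⇒≡false {false} p = refl

true≢false : ∀ {b} → b ≡ true → b ≡ false → ⊥
true≢false refl ()

edge-≡ : {e f : Edge n} → proj₁ e ≡ proj₁ f → proj₁ (proj₂ e) ≡ proj₁ (proj₂ f) → e ≡ f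
edge-≡ {e = i , j , p} {f = _ , _ , q} refl refl = cong (λ r → i , j , r) (FP.<-irrelevant p q)

==ₑ-refl : (e : Edge n) → (e ==ₑ e) ≡ true
==ₑ-refl (i , j , _) with i ≟ i | j ≟ j
... | yes _ | yes _ = refl
... | no ¬p | _     = ⊥-elim (¬p refl)
... | yes _ | no ¬p = ⊥-elim (¬p refl)

==ₑ⇒≡ : {e f : Edge n} → (e ==ₑ f) ≡ true → e ≡ f
==ₑ⇒≡ {e = i , j , _} {f = i′ , j′ , _} eq with i ≟ i′ | j ≟ j′
... | yes p | yes q = edge-≡ p q
==ₑ⇒≡ () | yes _ | no _
==ₑ⇒≡ () | no _  | yes _
==ₑ⇒≡ () | no _  | no _

_≟ₑ_ : (e f : Edge n) → Dec (e ≡ f)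
e ≟ₑ f with e ==ₑ f in eq
... | true  = yes (==ₑ⇒≡ eq)
... | false = no λ where refl → true≢false (==ₑ-refl e) eq

≢⇒==ₑfalse : {e f : Edge n} → e ≢ f → (e ==ₑ f) ≡ false
≢⇒==ₑfalse e≢f = ≢true⇒≡false (e≢f ∘ ==ₑ⇒≡)

-- The enumeration of the edges

private
  -- Unification recovers the local function of allEdges, which has no name outside Defs.
  pick : ∀ n → Σ (Fin n → Fin n → List (Edge n)) λ p →
         allEdges n ≡ concatMap (λ i → concatMap (λ j → p i j) (allFin n)) (allFin n)
  pick n = _ , refl

  ∈-pick : ∀ (e : Edge n) → e ∈ proj₁ (pick n) (proj₁ e) (proj₁ (proj₂ e))
  ∈-pick (i , j , p) with i F.<? j
  ... | yes q = here (edge-≡ refl refl)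
  ... | no ¬p = ⊥-elim (¬p p)

  ∈-pick⁻ : ∀ i j {e : Edge n} → e ∈ proj₁ (pick n) i j → proj₁ e ≡ i × proj₁ (proj₂ e) ≡ j
  ∈-pick⁻ i j e∈ with i F.<? j
  ∈-pick⁻ i j (here refl) | yes q = refl , refl

  pick-unique : ∀ i j → Unique (proj₁ (pick n) i j)
  pick-unique i j with i F.<? j
  ... | yes _ = [] ∷ []
  ... | no _  = []

∈-allEdges : (e : Edge n) → e ∈ allEdges n
∈-allEdges e@(i , j , _) = ∈-concatMap⁺ _ (lose (∈-allFin i) (∈-concatMap⁺ _ (lose (∈-allFin j) (∈-pick e))))

concatMap-unique : {A B : Set} (f : A → List B) → (∀ x → Unique (f x)) →
  (∀ {x y z} → z ∈ f x → z ∈ f y → x ≡ y) → ∀ {xs} → Unique xs → Unique (concatMap f xs)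
concatMap-unique f uf inj {xs} u =
  UniqueP.concat⁺ (AllP.map⁺ (All.universal uf xs))
    (AllPairsP.map⁺ (AllPairs.map (λ x≢y {_} (p , q) → x≢y (inj p q)) u))

allEdges-unique : ∀ n → Unique (allEdges n)
allEdges-unique n = concatMap-unique _
  (λ i → concatMap-unique _ (pick-unique i)
    (λ {x} {y} p q → trans (sym (proj₂ (∈-pick⁻ i x p))) (proj₂ (∈-pick⁻ i y q)))
    (UniqueP.allFin⁺ n))
  (λ {x} {y} p q → trans (sym (fst x p)) (fst y q)) (UniqueP.allFin⁺ n)
  where
  fst : ∀ i {e} → e ∈ concatMap (proj₁ (pick n) i) (allFin n) → proj₁ e ≡ i
  fst i p with _ , _ , q ← find (∈-concatMap⁻ (proj₁ (pick n) i) {xs = allFin n} p) = proj₁ (∈-pick⁻ i _ q)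

anyEdge? : {P : Edge n → Set} → (∀ e → Dec (P e)) → Dec (∃ P)
anyEdge? {n} P? = map′ Any.satisfied (λ (e , p) → lose (∈-allEdges e) p) (Any.any? P? (allEdges n))

allEdge? : {P : Edge n → Set} → (∀ e → Dec (P e)) → Dec (∀ e → P e)
allEdge? {n} P? = map′ (λ ps e → All.lookup ps (∈-allEdges e)) (λ p → All.universal p _) (All.all? P? (allEdges n))

_⊆ₑ?_ : (A B : ESet n) → Dec (A ⊆ₑ B)
A ⊆ₑ? B = allEdge? λ e → (A e BP.≟ true) →-dec (B e BP.≟ true)

⊈⇒∃ : {A B : ESet n} → ¬ (A ⊆ₑ B) → ∃[ e ] (e ∈ₑ A × ¬ (e ∈ₑ B))
⊈⇒∃ {A = A} {B} A⊈B with anyEdge? (λ e → (A e BP.≟ true) ×-dec ¬? (B e BP.≟ true))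
... | yes p = p
... | no ¬p = ⊥-elim (A⊈B λ e a → decidable-stable (B e BP.≟ true) λ b → ¬p (e , a , b))

-- Cardinality

∈-insert : (e : Edge n) (A : ESet n) → e ∈ₑ insertₑ e A
∈-insert e A = trans (cong (A e ∨_) (==ₑ-refl e)) (∨-zeroʳ (A e))

⊆-insert : (e : Edge n) (A : ESet n) → A ⊆ₑ insertₑ e A
⊆-insert e A f p rewrite p = refl

insert⁻ : ∀ (e : Edge n) (A : ESet n) {f} → f ∈ₑ insertₑ e A → f ∈ₑ A ⊎ f ≡ e
insert⁻ e A {f} p with A f
... | true  = inj₁ refl
... | false = inj₂ (==ₑ⇒≡ p)

insert-⊆ : ∀ {e : Edge n} {A B} → e ∈ₑ B → A ⊆ₑ B → insertₑ e A ⊆ₑ B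
insert-⊆ {e = e} {A = A} e∈B A⊆B f p with insert⁻ e A p
... | inj₁ q    = A⊆B f q
... | inj₂ refl = e∈B

insert-mono : ∀ (e : Edge n) {A B} → A ⊆ₑ B → insertₑ e A ⊆ₑ insertₑ e B
insert-mono e {A} {B} p = insert-⊆ {A = A} {insertₑ e B} (∈-insert e B) λ f q → ⊆-insert e B f (p f q)

remove : Edge n → ESet n → ESet n
remove e A f = A f ∧ not (f ==ₑ e)

remove-∉ : (e : Edge n) (A : ESet n) → remove e A e ≡ false
remove-∉ e A rewrite ==ₑ-refl e = BP.∧-zeroʳ (A e)

remove⁻ : ∀ (e : Edge n) (A : ESet n) {f} → f ∈ₑ remove e A → f ∈ₑ A × f ≢ e
remove⁻ e A {f} p with A f | f ==ₑ e in eq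
... | true | false = refl , λ where refl → true≢false (==ₑ-refl f) eq

remove⁺ : ∀ (e : Edge n) (A : ESet n) {f} → f ∈ₑ A → f ≢ e → f ∈ₑ remove e A
remove⁺ e A {f} p f≢e rewrite p | ≢⇒==ₑfalse {e = f} {e} f≢e = refl

insert-remove : ∀ (e : Edge n) (A : ESet n) → e ∈ₑ A → A ≐ insertₑ e (remove e A)
insert-remove e A e∈ f with f ==ₑ e in eq
... | false = sym (trans (∨-identityʳ _) (BP.∧-identityʳ (A f)))
... | true with refl ← ==ₑ⇒≡ {e = f} {e} eq = trans e∈ (sym (∨-zeroʳ _))

private
  length-filter-cong : {A B : ESet n} (es : List (Edge n)) → (∀ {e} → e ∈ es → A e ≡ B e) →
    length (filterᵇ A es) ≡ length (filterᵇ B es)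
  length-filter-cong [] p = refl
  length-filter-cong {A = A} {B} (e ∷ es) p with A e | B e | p {e} (here refl)
  ... | true  | .true  | refl = cong suc (length-filter-cong es (p ∘ there))
  ... | false | .false | refl = length-filter-cong es (p ∘ there)

  length-filter-mono : {A B : ESet n} (es : List (Edge n)) → A ⊆ₑ B →
    length (filterᵇ A es) ≤ length (filterᵇ B es)
  length-filter-mono [] p = z≤n
  length-filter-mono {A = A} {B} (e ∷ es) p with A e in a | B e in b
  ... | true  | true  = s≤s (length-filter-mono es p)
  ... | false | false = length-filter-mono es p
  ... | false | true  = m≤n⇒m≤1+n (length-filter-mono es p)
  ... | true  | false = ⊥-elim (true≢false (p e a) b)

  insert-≢ : ∀ (e f : Edge n) (A : ESet n) → f ≢ e → insertₑ e A f ≡ A f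
  insert-≢ e f A f≢e = trans (cong (A f ∨_) (≢⇒==ₑfalse f≢e)) (∨-identityʳ (A f))

  length-filter-insert : ∀ {e : Edge n} {A} (es : List (Edge n)) → Unique es → e ∈ es → A e ≡ false →
    length (filterᵇ (insertₑ e A) es) ≡ suc (length (filterᵇ A es))
  length-filter-insert {e = e} {A} (f ∷ es) (f# ∷ u) (here refl) e∉
    rewrite e∉ | ==ₑ-refl e = cong suc (length-filter-cong es λ {g} p → insert-≢ e g A λ where refl → All.lookup f# p refl)
  length-filter-insert {e = e} {A} (f ∷ es) (f# ∷ u) (there p) e∉
    rewrite insert-≢ e f A (All.lookup f# p) with A f
  ... | true  = cong suc (length-filter-insert es u p e∉)
  ... | false = length-filter-insert es u p e∉

card-cong : {A B : ESet n} → A ≐ B → card A ≡ card B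
card-cong {n} p = length-filter-cong (allEdges n) λ {e} _ → p e

card-mono : {A B : ESet n} → A ⊆ₑ B → card A ≤ card B
card-mono {n} = length-filter-mono (allEdges n)

card-insert : ∀ {e : Edge n} {A} → A e ≡ false → card (insertₑ e A) ≡ suc (card A)
card-insert {n} {e} = length-filter-insert (allEdges n) (allEdges-unique n) (∈-allEdges e)

card-remove : ∀ (e : Edge n) (A : ESet n) → e ∈ₑ A → suc (card (remove e A)) ≡ card A
card-remove e A e∈ = sym (trans (card-cong (insert-remove e A e∈)) (card-insert {A = remove e A} (remove-∉ e A)))

card-∅ : card (∅ₑ {n}) ≡ 0
card-∅ {n} = go (allEdges n)
  where
  go : ∀ es → length (filterᵇ (∅ₑ {n}) es) ≡ 0
  go [] = refl
  go (_ ∷ es) = go es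

card-strict : ∀ {A B : ESet n} {e} → A ⊆ₑ B → e ∈ₑ B → ¬ (e ∈ₑ A) → card A < card B
card-strict {A = A} {B} {e} A⊆B e∈B e∉A = subst (_≤ card B) (card-insert {e = e} {A} (≢true⇒≡false e∉A))
  (card-mono {A = insertₑ e A} {B} (insert-⊆ {e = e} {A} {B} e∈B A⊆B))

⊆∧card≥⇒⊇ : {A B : ESet n} → A ⊆ₑ B → card B ≤ card A → B ⊆ₑ A
⊆∧card≥⇒⊇ {A = A} {B} A⊆B le = decidable-stable (B ⊆ₑ? A) λ B⊈A →
  let e , e∈B , e∉A = ⊈⇒∃ {A = B} {A} B⊈A in <⇒≱ (card-strict {A = A} {B} {e} A⊆B e∈B e∉A) le

card<⇒∃ : {A B : ESet n} → card A < card B → ∃[ e ] (e ∈ₑ B × ¬ (e ∈ₑ A))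
card<⇒∃ {A = A} {B} lt = ⊈⇒∃ λ B⊆A → <⇒≱ lt (card-mono {A = B} {A} B⊆A)

-- Degree parities

-- The incidence vector is written as a sum of two indicators modulo 2, so that boundaries telescope
-- along a path.
inc : Fin n → Edge n → Bool
inc x (i , j , _) = ⌊ x ≟ i ⌋ xor ⌊ x ≟ j ⌋

par : Fin n → ESet n → Bool
par {n} x A = foldr (λ e b → (A e ∧ inc x e) xor b) false (allEdges n)

-- Membership in the cycle space over the two-element field.
Even : ESet n → Set
Even A = ∀ x → par x A ≡ false

private
  xor-interchange : ∀ a b c d → (a xor b) xor (c xor d) ≡ (a xor c) xor (b xor d)
  xor-interchange a b c d = begin
    (a xor b) xor (c xor d) ≡⟨ xor-assoc a b (c xor d) ⟩
    a xor (b xor (c xor d)) ≡⟨ cong (a xor_) (xor-assoc b c d) ⟨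
    a xor ((b xor c) xor d) ≡⟨ cong (λ t → a xor (t xor d)) (xor-comm b c) ⟩
    a xor ((c xor b) xor d) ≡⟨ cong (a xor_) (xor-assoc c b d) ⟩
    a xor (c xor (b xor d)) ≡⟨ xor-assoc a c (b xor d) ⟨
    (a xor c) xor (b xor d) ∎
    where open ≡-Reasoning

par-cong : ∀ (x : Fin n) {A B} → A ≐ B → par x A ≡ par x B
par-cong {n} x {A} {B} p = go (allEdges n)
  where
  go : ∀ es → foldr (λ e b → (A e ∧ inc x e) xor b) false es ≡ foldr (λ e b → (B e ∧ inc x e) xor b) false es
  go [] = refl
  go (e ∷ es) = cong₂ (λ a b → (a ∧ inc x e) xor b) (p e) (go es)

Even-cong : {A B : ESet n} → A ≐ B → Even A → Even B
Even-cong p ev x = trans (par-cong x (≐-sym p)) (ev x)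

par-isolated : ∀ (x : Fin n) {A} → (∀ e → e ∈ₑ A → inc x e ≡ false) → par x A ≡ false
par-isolated {n} x {A} p = go (allEdges n)
  where
  go : ∀ es → foldr (λ e b → (A e ∧ inc x e) xor b) false es ≡ false
  go [] = refl
  go (e ∷ es) with A e in a
  ... | false = go es
  ... | true rewrite p e a = go es

par-xor : ∀ (x : Fin n) A B → par x (λ e → A e xor B e) ≡ par x A xor par x B
par-xor {n} x A B = go (allEdges n)
  where
  go : ∀ es → foldr (λ e b → ((A e xor B e) ∧ inc x e) xor b) false es ≡
       foldr (λ e b → (A e ∧ inc x e) xor b) false es xor foldr (λ e b → (B e ∧ inc x e) xor b) false es
  go [] = refl
  go (e ∷ es) = trans (cong₂ _xor_ (BP.∧-distribʳ-xor (inc x e) (A e) (B e)) (go es))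
                      (xor-interchange (A e ∧ inc x e) (B e ∧ inc x e) _ _)

Even-xor : {A B : ESet n} → Even A → Even B → Even (λ e → A e xor B e)
Even-xor {A = A} {B} p q x = trans (par-xor x A B) (cong₂ _xor_ (p x) (q x))

par-single : ∀ (x : Fin n) e → par x (_==ₑ e) ≡ inc x e
par-single {n} x e = go (allEdges n) (allEdges-unique n) (∈-allEdges e)
  where
  S : List (Edge n) → Bool
  S = foldr (λ f b → ((f ==ₑ e) ∧ inc x f) xor b) false
  none : ∀ es → All (e ≢_) es → S es ≡ false
  none [] [] = refl
  none (f ∷ es) (e≢f ∷ a) rewrite ≢⇒==ₑfalse (e≢f ∘ sym) = none es a
  go : ∀ es → Unique es → e ∈ es → S es ≡ inc x e
  go (f ∷ es) (f# ∷ u) (here refl) rewrite ==ₑ-refl e | none es f# = xor-identityʳ _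
  go (f ∷ es) (f# ∷ u) (there p) rewrite ≢⇒==ₑfalse (All.lookup f# p) = go es u p

par-insert : ∀ (x : Fin n) {e A} → A e ≡ false → par x (insertₑ e A) ≡ par x A xor inc x e
par-insert x {e} {A} e∉ = trans (par-cong x disj) (trans (par-xor x A (_==ₑ e)) (cong (par x A xor_) (par-single x e)))
  where
  disj : insertₑ e A ≐ (λ f → A f xor (f ==ₑ e))
  disj f with A f in a
  ... | false = refl
  ... | true = cong not (sym (≢⇒==ₑfalse {e = f} {e} λ where refl → true≢false a e∉))

inc-fst : (e : Edge n) → inc (proj₁ e) e ≡ true
inc-fst (i , j , p) with i ≟ i | i ≟ j
... | no ¬p | _        = ⊥-elim (¬p refl)
... | yes _ | yes refl = ⊥-elim (FP.<-irrefl refl p)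
... | yes _ | no _     = refl

inc-snd : (e : Edge n) → inc (proj₁ (proj₂ e)) e ≡ true
inc-snd (i , j , p) with j ≟ i | j ≟ j
... | _        | no ¬p = ⊥-elim (¬p refl)
... | yes refl | yes _ = ⊥-elim (FP.<-irrefl refl p)
... | no _     | yes _ = refl

inc⁻ : ∀ {x} (e : Edge n) → inc x e ≡ true → x ≡ proj₁ e ⊎ x ≡ proj₁ (proj₂ e)
inc⁻ {x = x} (i , j , _) p with x ≟ i | x ≟ j
... | yes q | _     = inj₁ q
... | no _  | yes q = inj₂ q
inc⁻ (i , j , _) () | no _ | no _

inc-injective : {e f : Edge n} → (∀ x → inc x e ≡ inc x f) → e ≡ f
inc-injective {e = e} {f} eq
  with inc⁻ f (trans (sym (eq (proj₁ e))) (inc-fst e)) | inc⁻ f (trans (sym (eq (proj₁ (proj₂ e)))) (inc-snd e))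
... | inj₁ p | inj₂ q = edge-≡ p q
... | inj₁ p | inj₁ q = ⊥-elim (FP.<-irrefl (trans p (sym q)) (proj₂ (proj₂ e)))
... | inj₂ p | inj₂ q = ⊥-elim (FP.<-irrefl (trans p (sym q)) (proj₂ (proj₂ e)))
... | inj₂ p | inj₁ q = ⊥-elim (FP.<-asym (proj₂ (proj₂ f)) (subst₂ F._<_ p q (proj₂ (proj₂ e))))

¬Even-insert : {A : ESet n} → Even A → ∀ {e} → A e ≡ false → ¬ Even (insertₑ e A)
¬Even-insert {A = A} ev {e} e∉ ev′ =
  true≢false (trans (cong₂ _xor_ (ev i) (inc-fst e)) refl) (trans (sym (par-insert i {e} {A} e∉)) (ev′ i))
  where i = proj₁ e

-- The parities of `A` dictate the ends of the missing edge, and an edge is determined by its ends.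
Even-insert-injective : ∀ {A : ESet n} {e f} → A e ≡ false → A f ≡ false →
  Even (insertₑ e A) → Even (insertₑ f A) → e ≡ f
Even-insert-injective {A = A} {e} {f} e∉ f∉ p q = inc-injective λ x →
  xor-cancel (par x A) (trans (trans (sym (par-insert x {e} {A} e∉)) (p x)) (sym (trans (sym (par-insert x {f} {A} f∉)) (q x))))
  where
  xor-cancel : ∀ a {b c} → a xor b ≡ a xor c → b ≡ c
  xor-cancel false eq = eq
  xor-cancel true  eq = BP.not-injective eq

-- Paths and cycles

endsAt? : (e : Edge n) (a b : Fin n) → Dec (EndsAt e a b)
endsAt? (i , j , _) a b = ((i ≟ a) ×-dec (j ≟ b)) ⊎-dec ((i ≟ b) ×-dec (j ≟ a))

EndsAt-sym : ∀ (e : Edge n) {a b} → EndsAt e a b → EndsAt e b a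
EndsAt-sym _ (inj₁ p) = inj₂ p
EndsAt-sym _ (inj₂ p) = inj₁ p

EndsAt-irrefl : ∀ (e : Edge n) {a} → ¬ EndsAt e a a
EndsAt-irrefl (_ , _ , p) (inj₁ (refl , refl)) = FP.<-irrefl refl p
EndsAt-irrefl (_ , _ , p) (inj₂ (refl , refl)) = FP.<-irrefl refl p

EndsAt-unique : ∀ {e f : Edge n} {a b} → EndsAt e a b → EndsAt f a b → e ≡ f
EndsAt-unique (inj₁ (refl , refl)) (inj₁ (refl , refl)) = edge-≡ refl refl
EndsAt-unique (inj₂ (refl , refl)) (inj₂ (refl , refl)) = edge-≡ refl refl
EndsAt-unique {e = _ , _ , p} {_ , _ , q} (inj₁ (refl , refl)) (inj₂ (refl , refl)) = ⊥-elim (FP.<-asym p q)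
EndsAt-unique {e = _ , _ , p} {_ , _ , q} (inj₂ (refl , refl)) (inj₁ (refl , refl)) = ⊥-elim (FP.<-asym p q)

EndsAt-cancel : ∀ (e : Edge n) {a b c} → EndsAt e a b → EndsAt e a c → b ≡ c
EndsAt-cancel _ (inj₁ (refl , refl)) (inj₁ (_ , q))       = q
EndsAt-cancel _ (inj₁ (refl , refl)) (inj₂ (refl , refl)) = refl
EndsAt-cancel _ (inj₂ (refl , refl)) (inj₁ (refl , refl)) = refl
EndsAt-cancel _ (inj₂ (refl , refl)) (inj₂ (q , _))       = q

edgeBetween : {a b : Fin n} → a ≢ b → ∃[ e ] EndsAt e a b
edgeBetween {a = a} {b} a≢b with FP.<-cmp a b
... | tri< lt _ _ = (a , b , lt) , inj₁ (refl , refl)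
... | tri≈ _ eq _ = ⊥-elim (a≢b eq)
... | tri> _ _ gt = (b , a , gt) , inj₂ (refl , refl)

inc-EndsAt : ∀ x (e : Edge n) {a b} → EndsAt e a b → inc x e ≡ ⌊ x ≟ a ⌋ xor ⌊ x ≟ b ⌋
inc-EndsAt x e (inj₁ (refl , refl)) = refl
inc-EndsAt x e {a} {b} (inj₂ (refl , refl)) = xor-comm ⌊ x ≟ b ⌋ ⌊ x ≟ a ⌋

link : Fin n → Fin n → ESet n
link a b f = ⌊ endsAt? f a b ⌋

link⁻ : ∀ {a b} (f : Edge n) → f ∈ₑ link a b → EndsAt f a b
link⁻ {a = a} {b} f p with endsAt? f a b
... | yes q = q

link⁺ : ∀ {a b} (f : Edge n) → EndsAt f a b → f ∈ₑ link a b
link⁺ {a = a} {b} f p with endsAt? f a b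
... | yes _ = refl
... | no ¬p = ⊥-elim (¬p p)

link≐ : ∀ (e : Edge n) {a b} → EndsAt e a b → link a b ≐ (_==ₑ e)
link≐ e {a} {b} ee = ⊆-antisym {A = link a b} {_==ₑ e} (λ f p → subst (λ g → (f ==ₑ g) ≡ true) (EndsAt-unique {e = f} {e} (link⁻ f p) ee) (==ₑ-refl f))
  λ f p → link⁺ f (subst (λ g → EndsAt g a b) (sym (==ₑ⇒≡ {e = f} {e} p)) ee)

-- The new link is the right operand, as in `insertₑ`, so that prepending a vertex is an insertion
-- up to `_≐_`.
pathSet : List (Fin n) → ESet n
pathSet []          = ∅ₑ
pathSet (a ∷ [])    = ∅ₑ
pathSet (a ∷ b ∷ r) = λ f → pathSet (b ∷ r) f ∨ link a b f

lastOf : Fin n → List (Fin n) → Fin n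
lastOf a []      = a
lastOf a (b ∷ r) = lastOf b r

cycleSet : Fin n → List (Fin n) → ESet n
cycleSet a r f = pathSet (a ∷ r) f ∨ link (lastOf a r) a f

∨⁻ : ∀ a {b} → a ∨ b ≡ true → a ≡ true ⊎ b ≡ true
∨⁻ true  _ = inj₁ refl
∨⁻ false p = inj₂ p

∨⁺ʳ : ∀ a {b} → b ≡ true → a ∨ b ≡ true
∨⁺ʳ a refl = ∨-zeroʳ a

∨⁺ˡ : ∀ {a b} → a ≡ true → a ∨ b ≡ true
∨⁺ˡ refl = refl

lastOf-∈ : (a : Fin n) (r : List (Fin n)) → lastOf a r ∈ a ∷ r
lastOf-∈ a []      = here refl
lastOf-∈ a (b ∷ r) = there (lastOf-∈ b r)

∨-link≐insert : ∀ (A : ESet n) e {a b} → EndsAt e a b → (λ f → A f ∨ link a b f) ≐ insertₑ e A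
∨-link≐insert A e ee f = cong (A f ∨_) (link≐ e ee f)

EndsAt-∈ : ∀ (f : Edge n) {a b l} → EndsAt f a b → f ∈ₑ pathSet l → a ∈ l
EndsAt-∈ f {a} {l = l@(c ∷ r)} fe p = go fe (pathSet-ends c r p)
  where
  pathSet-ends : ∀ c r → f ∈ₑ pathSet (c ∷ r) → proj₁ f ∈ c ∷ r × proj₁ (proj₂ f) ∈ c ∷ r
  pathSet-ends c (d ∷ r) p with ∨⁻ (pathSet (d ∷ r) f) p
  ... | inj₁ q = Prod.map there there (pathSet-ends d r q)
  ... | inj₂ q with link⁻ f q
  ...   | inj₁ (x , y) = here x , there (here y)
  ...   | inj₂ (x , y) = there (here x) , here y
  go : ∀ {b} → EndsAt f a b → proj₁ f ∈ l × proj₁ (proj₂ f) ∈ l → a ∈ l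
  go (inj₁ (refl , _)) (x , _) = x
  go (inj₂ (_ , refl)) (_ , y) = y

∉-pathSet : ∀ (f : Edge n) {a b l} → EndsAt f a b → All (a ≢_) l → pathSet l f ≡ false
∉-pathSet f fe a# = ≢true⇒≡false λ p → All.lookup a# (EndsAt-∈ f fe p) refl

EndsAt-∈-cycle : ∀ (f : Edge n) {x y a} r → EndsAt f x y → f ∈ₑ cycleSet a r → x ∈ a ∷ r
EndsAt-∈-cycle f {x} {y} {a} r fe p with ∨⁻ (pathSet (a ∷ r) f) p
... | inj₁ q = EndsAt-∈ f fe q
... | inj₂ q with fe | link⁻ f q
...   | inj₁ (refl , _) | inj₁ (refl , _) = lastOf-∈ a r
...   | inj₁ (refl , _) | inj₂ (s , _)    = here s
...   | inj₂ (_ , refl) | inj₁ (_ , s)    = here s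
...   | inj₂ (_ , refl) | inj₂ (_ , refl) = lastOf-∈ a r

card-pathSet : ∀ (a : Fin n) r → Unique (a ∷ r) → card (pathSet (a ∷ r)) ≡ length r
card-pathSet {n} a [] _ = card-∅ {n}
card-pathSet a (b ∷ r) ((a≢b ∷ a#) ∷ u) with e , ee ← edgeBetween a≢b =
  trans (card-cong (∨-link≐insert (pathSet (b ∷ r)) e ee))
  (trans (card-insert {e = e} {pathSet (b ∷ r)} (∉-pathSet e ee (a≢b ∷ a#))) (cong suc (card-pathSet b r u)))

-- Inner vertices are counted twice and cancel, which leaves the two ends of the path.
par-pathSet : ∀ x (a : Fin n) r → Unique (a ∷ r) → par x (pathSet (a ∷ r)) ≡ ⌊ x ≟ a ⌋ xor ⌊ x ≟ lastOf a r ⌋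
par-pathSet x a [] _ = trans (par-isolated x {∅ₑ} λ _ ()) (sym (xor-same ⌊ x ≟ a ⌋))
par-pathSet x a (b ∷ r) ((a≢b ∷ a#) ∷ u) with e , ee ← edgeBetween a≢b = begin
  par x (pathSet (a ∷ b ∷ r))
    ≡⟨ par-cong x (∨-link≐insert (pathSet (b ∷ r)) e ee) ⟩
  par x (insertₑ e (pathSet (b ∷ r)))
    ≡⟨ par-insert x {e} {pathSet (b ∷ r)} (∉-pathSet e ee (a≢b ∷ a#)) ⟩
  par x (pathSet (b ∷ r)) xor inc x e
    ≡⟨ cong₂ _xor_ (par-pathSet x b r u) (inc-EndsAt x e ee) ⟩
  (δ b xor δ z) xor (δ a xor δ b)
    ≡⟨ telescope (δ a) (δ b) (δ z) ⟩
  δ a xor δ z ∎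
  where
  open ≡-Reasoning
  z = lastOf b r
  δ : Fin _ → Bool
  δ y = ⌊ x ≟ y ⌋
  telescope : ∀ a b z → (b xor z) xor (a xor b) ≡ a xor z
  telescope false false z = xor-identityʳ z
  telescope false true  false = refl
  telescope false true  true  = refl
  telescope true  false false = refl
  telescope true  false true  = refl
  telescope true  true  false = refl
  telescope true  true  true  = refl

-- The first vertex has degree at most one, so its edge is not in an even set; repeat.
pathSet-acyclic : ∀ {D : ESet n} l → Unique l → D ⊆ₑ pathSet l → Even D → ∀ e → ¬ (e ∈ₑ D)
pathSet-acyclic [] _ D⊆ _ e e∈ = case D⊆ e e∈ of λ ()
pathSet-acyclic (_ ∷ []) _ D⊆ _ e e∈ = case D⊆ e e∈ of λ ()
pathSet-acyclic {n} {D} (a ∷ b ∷ r) ((a≢b ∷ a#) ∷ u) D⊆ ev with e , ee ← edgeBetween a≢b =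
  pathSet-acyclic (b ∷ r) u D⊆′ ev
  where
  ∈tail : ∀ f → f ∈ₑ D → f ≢ e → f ∈ₑ pathSet (b ∷ r)
  ∈tail f f∈ f≢e with ∨⁻ (pathSet (b ∷ r) f) (D⊆ f f∈)
  ... | inj₁ p = p
  ... | inj₂ p = ⊥-elim (f≢e (EndsAt-unique (link⁻ f p) ee))
  isolated : ∀ f → f ∈ₑ remove e D → inc a f ≡ false
  isolated f p = ≢true⇒≡false λ i → All.lookup (a≢b ∷ a#) (a∈ (inc⁻ f i)) refl
    where
    f∈r = let f∈D , f≢e = remove⁻ e D {f} p in ∈tail f f∈D f≢e
    a∈ : a ≡ proj₁ f ⊎ a ≡ proj₁ (proj₂ f) → a ∈ b ∷ r
    a∈ (inj₁ refl) = EndsAt-∈ f (inj₁ (refl , refl)) f∈r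
    a∈ (inj₂ refl) = EndsAt-∈ f (inj₂ (refl , refl)) f∈r
  inca : inc a e ≡ true
  inca = trans (inc-EndsAt a e ee) (go (a ≟ a) (a ≟ b))
    where
    go : (p : Dec (a ≡ a)) (q : Dec (a ≡ b)) → ⌊ p ⌋ xor ⌊ q ⌋ ≡ true
    go (yes _) (no _)  = refl
    go (yes _) (yes q) = ⊥-elim (a≢b q)
    go (no ¬p) _       = ⊥-elim (¬p refl)
  e∉D : ¬ (e ∈ₑ D)
  e∉D e∈ = true≢false
    (trans (par-cong a (insert-remove e D e∈)) (trans (par-insert a {e} {remove e D} (remove-∉ e D))
      (cong₂ _xor_ (par-isolated a {remove e D} isolated) inca)))
    (ev a)
  D⊆′ : D ⊆ₑ pathSet (b ∷ r)
  D⊆′ f f∈ = ∈tail f f∈ λ where refl → e∉D f∈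

module _ {a b c : Fin n} {r : List (Fin n)} (u : Unique (a ∷ b ∷ c ∷ r)) where

  private
    z = lastOf c r
    z≢a : z ≢ a
    z≢a z≡a = All.lookup (All.tail (AllPairs.head u)) (lastOf-∈ c r) (sym z≡a)

  closingEdge : ∃[ e ] EndsAt e z a
  closingEdge = edgeBetween z≢a

  -- The only path edge at `a` leads to `b`, and with three or more vertices the last vertex is not
  -- `b`.
  closingEdge∉ : ∀ {e} → EndsAt e z a → pathSet (a ∷ b ∷ c ∷ r) e ≡ false
  closingEdge∉ {e} ee = ≢true⇒≡false (absurd ∘ ∨⁻ (pathSet (b ∷ c ∷ r) e))
    where
    second : z ≡ b → ⊥
    second z≡b = All.lookup (AllPairs.head (AllPairs.tail u)) (lastOf-∈ c r) (sym z≡b)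
    absurd : e ∈ₑ pathSet (b ∷ c ∷ r) ⊎ e ∈ₑ link a b → ⊥
    absurd (inj₁ q) = true≢false q (∉-pathSet e (EndsAt-sym e ee) (AllPairs.head u))
    absurd (inj₂ q) = second (EndsAt-cancel e (EndsAt-sym e ee) (link⁻ e q))

  cycleSet≐ : ∀ e → EndsAt e z a → cycleSet a (b ∷ c ∷ r) ≐ insertₑ e (pathSet (a ∷ b ∷ c ∷ r))
  cycleSet≐ e ee = ∨-link≐insert (pathSet (a ∷ b ∷ c ∷ r)) e ee

  card-cycleSet : card (cycleSet a (b ∷ c ∷ r)) ≡ 3 + length r
  card-cycleSet with e , ee ← closingEdge =
    trans (card-cong (cycleSet≐ e ee)) (trans (card-insert {e = e} {pathSet (a ∷ b ∷ c ∷ r)} (closingEdge∉ ee))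
      (cong suc (card-pathSet a (b ∷ c ∷ r) u)))

  Even-cycleSet : Even (cycleSet a (b ∷ c ∷ r))
  Even-cycleSet x with e , ee ← closingEdge =
    trans (par-cong x (cycleSet≐ e ee)) (trans (par-insert x {e} {pathSet (a ∷ b ∷ c ∷ r)} (closingEdge∉ ee))
      (trans (cong₂ _xor_ (par-pathSet x a (b ∷ c ∷ r) u) (trans (inc-EndsAt x e ee) (xor-comm ⌊ x ≟ z ⌋ ⌊ x ≟ a ⌋)))
        (xor-same (⌊ x ≟ a ⌋ xor ⌊ x ≟ z ⌋))))

  -- An even subset avoiding the closing edge lies in a path; otherwise its complement in the cycle does.
  cycleSet-minimal : ∀ {D f} → D ⊆ₑ cycleSet a (b ∷ c ∷ r) → f ∈ₑ cycleSet a (b ∷ c ∷ r) → ¬ (f ∈ₑ D) →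
    Even D → ∀ g → ¬ (g ∈ₑ D)
  cycleSet-minimal {D} {f} D⊆ f∈ f∉ ev with e , ee ← closingEdge = main (D e) refl
    where
    S P : ESet n
    S = cycleSet a (b ∷ c ∷ r)
    P = pathSet (a ∷ b ∷ c ∷ r)
    ∈P : ∀ g → g ∈ₑ S → g ≢ e → g ∈ₑ P
    ∈P g p g≢e with insert⁻ e P {g} (trans (sym (cycleSet≐ e ee g)) p)
    ... | inj₁ q = q
    ... | inj₂ q = ⊥-elim (g≢e q)
    e∈S : e ∈ₑ S
    e∈S = trans (cycleSet≐ e ee e) (∈-insert e P)
    main : ∀ d → D e ≡ d → ∀ g → ¬ (g ∈ₑ D)
    main false De = pathSet-acyclic _ u (λ g p → ∈P g (D⊆ g p) λ where refl → true≢false p De) ev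
    main true  De = ⊥-elim (pathSet-acyclic {D = λ g → S g xor D g} _ u
        (λ g p → ∈P g (xor⊆ (S g) (D g) (D⊆ g) p) λ where refl → true≢false p (cong₂ _xor_ e∈S De))
        (Even-xor {A = S} {D} Even-cycleSet ev) f (trans (cong₂ _xor_ f∈ (≢true⇒≡false f∉)) refl))
      where
      xor⊆ : ∀ s d → (d ≡ true → s ≡ true) → s xor d ≡ true → s ≡ true
      xor⊆ true  d     _ _ = refl
      xor⊆ false true  h _ = h refl
      xor⊆ false false _ ()

-- Vertex lists against the cyclic maps of `IsCkSet`

nextFin-inject₁ : ∀ {m} (i : Fin m) → nextFin (inject₁ i) ≡ suc i
nextFin-inject₁ {m} i = FP.toℕ-injective (begin
  toℕ (nextFin (inject₁ i))       ≡⟨ FP.toℕ-fromℕ< _ ⟩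
  suc (toℕ (inject₁ i)) % suc m   ≡⟨ cong (λ t → suc t % suc m) (FP.toℕ-inject₁ i) ⟩
  suc (toℕ i) % suc m             ≡⟨ m<n⇒m%n≡m (s≤s (FP.toℕ<n i)) ⟩
  suc (toℕ i)                     ∎)
  where open ≡-Reasoning

nextFin-fromℕ : ∀ m → nextFin (fromℕ m) ≡ zero
nextFin-fromℕ m = FP.toℕ-injective (begin
  toℕ (nextFin (fromℕ m))     ≡⟨ FP.toℕ-fromℕ< _ ⟩
  suc (toℕ (fromℕ m)) % suc m ≡⟨ cong (λ t → suc t % suc m) (FP.toℕ-fromℕ m) ⟩
  suc m % suc m               ≡⟨ n%n≡0 (suc m) ⟩
  0                           ∎)
  where open ≡-Reasoning

lastOf-tabulate : ∀ {m} (v : Fin (suc m) → Fin n) → lastOf (v zero) (tabulate (v ∘ suc)) ≡ v (fromℕ m)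
lastOf-tabulate {m = zero}  v = refl
lastOf-tabulate {m = suc m} v = lastOf-tabulate (v ∘ suc)

pathSet-tabulate⁻ : ∀ {m} (v : Fin (suc m) → Fin n) e → e ∈ₑ pathSet (tabulate v) →
  ∃[ i ] EndsAt e (v (inject₁ i)) (v (suc i))
pathSet-tabulate⁻ {m = suc m} v e p with ∨⁻ (pathSet (tabulate (v ∘ suc)) e) p
... | inj₁ q = let i , r = pathSet-tabulate⁻ (v ∘ suc) e q in suc i , r
... | inj₂ q = zero , link⁻ e q

pathSet-tabulate⁺ : ∀ {m} (v : Fin (suc m) → Fin n) e i → EndsAt e (v (inject₁ i)) (v (suc i)) →
  e ∈ₑ pathSet (tabulate v)
pathSet-tabulate⁺ {m = suc m} v e zero    p = ∨⁺ʳ (pathSet (tabulate (v ∘ suc)) e) (link⁺ e p)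
pathSet-tabulate⁺ {m = suc m} v e (suc i) p = ∨⁺ˡ (pathSet-tabulate⁺ (v ∘ suc) e i p)

cycleSet-tabulate : ∀ {m} (v : Fin (suc m) → Fin n) e →
  e ∈ₑ cycleSet (v zero) (tabulate (v ∘ suc)) ⇔ (∃[ t ] EndsAt e (v t) (v (nextFin t)))
cycleSet-tabulate {m = m} v e = mk⇔ to from
  where
  to : e ∈ₑ cycleSet (v zero) (tabulate (v ∘ suc)) → ∃[ t ] EndsAt e (v t) (v (nextFin t))
  to p with ∨⁻ (pathSet (tabulate v) e) p
  ... | inj₁ q = let i , r = pathSet-tabulate⁻ v e q in
                 inject₁ i , subst (λ t → EndsAt e (v (inject₁ i)) (v t)) (sym (nextFin-inject₁ i)) r
  ... | inj₂ q = fromℕ m , subst (λ t → EndsAt e (v (fromℕ m)) (v t)) (sym (nextFin-fromℕ m))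
                   (subst (λ x → EndsAt e x (v zero)) (lastOf-tabulate v) (link⁻ e q))
  from : (∃[ t ] EndsAt e (v t) (v (nextFin t))) → e ∈ₑ cycleSet (v zero) (tabulate (v ∘ suc))
  from (t , p) with view t
  ... | ‵fromℕ = ∨⁺ʳ (pathSet (tabulate v) e) (link⁺ e
          (subst (λ x → EndsAt e x (v zero)) (sym (lastOf-tabulate v))
          (subst (λ s → EndsAt e (v (fromℕ m)) (v s)) (nextFin-fromℕ m) p)))
  ... | ‵inject₁ i = ∨⁺ˡ (pathSet-tabulate⁺ v e i
          (subst (λ s → EndsAt e (v (inject₁ i)) (v s)) (nextFin-inject₁ i) p))

IsCkSet⇒cycleSet : ∀ {m} {S : ESet n} → IsCkSet (3 + m) S →
  Σ (Fin n) λ a → Σ (Fin n) λ b → Σ (Fin n) λ c → Σ (List (Fin n)) λ r →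
    Unique (a ∷ b ∷ c ∷ r) × length r ≡ m × S ≐ cycleSet a (b ∷ c ∷ r)
IsCkSet⇒cycleSet {S = S} (v , inj , iff) =
  _ , _ , _ , _ , UniqueP.tabulate⁺ inj , length-tabulate _ ,
  ⊆-antisym {A = S} (λ e p → from (cycleSet-tabulate v e) (to (iff e) p))
                    (λ e p → from (iff e) (to (cycleSet-tabulate v e) p))
  where open Equivalence

cycleSet-IsCkSet : ∀ (a : Fin n) r → Unique (a ∷ r) → IsCkSet (suc (length r)) (cycleSet a r)
cycleSet-IsCkSet a r u = lookup (a ∷ r) , lookup-injective u , λ e →
  subst (λ l → e ∈ₑ cycleSet a l ⇔ (∃[ t ] EndsAt e (lookup (a ∷ r) t) (lookup (a ∷ r) (nextFin t))))
    (tabulate-lookup r) (cycleSet-tabulate (lookup (a ∷ r)) e)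
  where
  lookup-injective : ∀ {l : List (Fin _)} → Unique l → Injective _≡_ _≡_ (lookup l)
  lookup-injective (_ ∷ _) {zero} {zero} _ = refl
  lookup-injective {l = _ ∷ l} (a# ∷ u) {zero} {suc j} eq = ⊥-elim (All.lookup a# (∈-lookup j) eq)
  lookup-injective {l = _ ∷ l} (a# ∷ u) {suc i} {zero} eq = ⊥-elim (All.lookup a# (∈-lookup i) (sym eq))
  lookup-injective (_ ∷ u) {suc i} {suc j} eq = cong suc (lookup-injective u eq)

IsCkSet-cong : ∀ {k} {S T : ESet n} → S ≐ T → IsCkSet k S → IsCkSet k T
IsCkSet-cong p (v , inj , iff) = v , inj , λ e →
  mk⇔ (λ q → to (iff e) (trans (p e) q)) (λ q → trans (sym (p e)) (from (iff e) q))
  where open Equivalence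

card-IsCkSet : ∀ {m} {S : ESet n} → IsCkSet (3 + m) S → card S ≡ 3 + m
card-IsCkSet ck with _ , _ , _ , _ , u , refl , eq ← IsCkSet⇒cycleSet ck = trans (card-cong eq) (card-cycleSet u)

Even-IsCkSet : ∀ {m} {S : ESet n} → IsCkSet (3 + m) S → Even S
Even-IsCkSet ck with _ , _ , _ , _ , u , refl , eq ← IsCkSet⇒cycleSet ck = Even-cong (≐-sym eq) (Even-cycleSet u)

-- Exhaustive search over edge sets

sublists : {X : Set} → List X → List (List X)
sublists []       = [] ∷ []
sublists (x ∷ xs) = sublists xs ++ map (x ∷_) (sublists xs)

filter-∈-sublists : {X : Set} {P : X → Set} (P? : ∀ x → Dec (P x)) (xs : List X) → filter P? xs ∈ sublists xs
filter-∈-sublists P? [] = here refl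
filter-∈-sublists P? (x ∷ xs) with does (P? x)
... | true  = ∈-++⁺ʳ (sublists xs) (∈-map⁺ (x ∷_) (filter-∈-sublists P? xs))
... | false = ∈-++⁺ˡ (filter-∈-sublists P? xs)

private
  fromList : List (Edge n) → ESet n
  fromList l e = ⌊ Any.any? (e ≟ₑ_) l ⌋

  fromList⁻ : ∀ (l : List (Edge n)) e → e ∈ₑ fromList l → e ∈ l
  fromList⁻ l e p with Any.any? (e ≟ₑ_) l
  ... | yes q = q

  fromList⁺ : ∀ (l : List (Edge n)) e → e ∈ l → e ∈ₑ fromList l
  fromList⁺ l e p with Any.any? (e ≟ₑ_) l
  ... | yes _ = refl
  ... | no ¬p = ⊥-elim (¬p p)

allESets : ∀ n → List (ESet n)
allESets n = map fromList (sublists (allEdges n))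

∈-allESets : (A : ESet n) → Any (A ≐_) (allESets n)
∈-allESets {n} A = lose (∈-map⁺ fromList (filter-∈-sublists A? (allEdges n)))
  (⊆-antisym {A = A} {fromList (filter A? (allEdges n))}
    (λ e p → fromList⁺ _ e (∈-filter⁺ A? (∈-allEdges e) p))
    (λ e p → proj₂ (∈-filter⁻ A? {xs = allEdges n} (fromList⁻ _ e p))))
  where
  A? : ∀ e → Dec (e ∈ₑ A)
  A? e = A e BP.≟ true

-- Edge sets are functions, and the enumeration meets each of them only up to `_≐_`; a property can
-- be decided by search when it respects that equality.
Extensional : (ESet n → Set) → Set
Extensional P = ∀ {A B} → A ≐ B → P A → P B

anyESet? : {P : ESet n → Set} → Extensional P → (∀ A → Dec (P A)) → Dec (∃ P)
anyESet? {n} ext P? = map′ Any.satisfied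
  (λ (A , p) → Any.map (λ eq → ext eq p) (∈-allESets A)) (Any.any? P? (allESets n))

allESet? : {P : ESet n → Set} → Extensional P → (∀ A → Dec (P A)) → Dec (∀ A → P A)
allESet? {n} ext P? = map′
  (λ ps A → let B , B∈ , eq = find (∈-allESets A) in ext (≐-sym eq) (All.lookup ps B∈))
  (λ p → All.universal p _) (All.all? P? (allESets n))

-- The graphic matroid, as the binary matroid of even edge sets

HasEven : ESet n → Set
HasEven A = ∃[ D ] (D ⊆ₑ A × Even D × ∃[ e ] (e ∈ₑ D))

hasEven? : (A : ESet n) → Dec (HasEven A)
hasEven? A = anyESet?
  (λ eq (p , ev , e , q) → (λ f r → p f (trans (eq f) r)) , Even-cong eq ev , e , trans (sym (eq e)) q)
  (λ D → (D ⊆ₑ? A) ×-dec (FP.all? (λ x → par x D BP.≟ false)) ×-dec anyEdge? (λ e → D e BP.≟ true))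

HasEven-mono : {A B : ESet n} → A ⊆ₑ B → HasEven A → HasEven B
HasEven-mono A⊆B (D , D⊆ , rest) = D , (λ e → A⊆B e ∘ D⊆ e) , rest

xor⁻ : ∀ a {b} → a xor b ≡ true → a ≡ true ⊎ b ≡ true
xor⁻ true  _ = inj₁ refl
xor⁻ false p = inj₂ p

-- The even set Z in B + e is unique, so removing any of its edges destroys all even sets.
fundamental-exchange : {B Z : ESet n} {e f : Edge n} → ¬ HasEven B →
  Z ⊆ₑ insertₑ e B → Even Z → f ∈ₑ Z → ¬ HasEven (remove f (insertₑ e B))
fundamental-exchange {n} {B} {Z} {e} {f} ¬evB Z⊆ evZ f∈Z (D , D⊆ , evD , g , g∈D) =
  ¬evB (X , X⊆ , Even-xor {A = D} {Z} evD evZ , f , trans (cong₂ _xor_ (≢true⇒≡false f∉D) f∈Z) refl)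
  where
  X : ESet n
  X h = D h xor Z h
  avoid : {E : ESet n} → E ⊆ₑ insertₑ e B → ¬ (e ∈ₑ E) → E ⊆ₑ B
  avoid E⊆ e∉ h h∈ with insert⁻ e B {h} (E⊆ h h∈)
  ... | inj₁ p    = p
  ... | inj₂ refl = ⊥-elim (e∉ h∈)
  D⊆′ : D ⊆ₑ insertₑ e B
  D⊆′ h p = proj₁ (remove⁻ f (insertₑ e B) {h} (D⊆ h p))
  f∉D : ¬ (f ∈ₑ D)
  f∉D p = proj₂ (remove⁻ f (insertₑ e B) {f} (D⊆ f p)) refl
  e∈ : {E : ESet n} → E ⊆ₑ insertₑ e B → Even E → ∀ {h} → h ∈ₑ E → e ∈ₑ E
  e∈ {E} E⊆ ev {h} h∈ = decidable-stable (E e BP.≟ true) λ e∉ → ¬evB (E , avoid {E} E⊆ e∉ , ev , h , h∈)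
  X⊆ : X ⊆ₑ B
  X⊆ = avoid {X} (λ h p → case xor⁻ (D h) p of λ where
      (inj₁ q) → D⊆′ h q
      (inj₂ q) → Z⊆ h q)
    λ p → true≢false p (cong₂ _xor_ (e∈ {D} D⊆′ evD g∈D) (e∈ {Z} Z⊆ evZ f∈Z))

module _ {A B : ESet n} (¬evA : ¬ HasEven A) (¬evB : ¬ HasEven B) (A<B : card A < card B) where

  private
    -- B is traded for edges of A one at a time, staying independent and larger than A, until it contains A.
    record Exchanged (es : List (Edge n)) : Set where
      field
        set   : ESet n
        indep : ¬ HasEven set
        large : card A < card set
        ⊆∪    : ∀ f → f ∈ₑ set → f ∈ₑ A ⊎ f ∈ₑ B
        ⊇     : ∀ f → f ∈ es → f ∈ₑ A → f ∈ₑ set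

    exchange : ∀ es → Exchanged es
    exchange [] = record { set = B ; indep = ¬evB ; large = A<B ; ⊆∪ = λ _ → inj₂ ; ⊇ = λ _ () }
    exchange (e ∷ es) with exchange es
    ... | record { set = B′ ; indep = ¬evB′ ; large = A<B′ ; ⊆∪ = ⊆∪ ; ⊇ = ⊇ }
      with A e BP.≟ true | B′ e BP.≟ true
    ... | no e∉A | _ = record { set = B′ ; indep = ¬evB′ ; large = A<B′ ; ⊆∪ = ⊆∪
            ; ⊇ = λ { f (here refl) e∈A → ⊥-elim (e∉A e∈A) ; f (there p) → ⊇ f p } }
    ... | yes _ | yes e∈B′ = record { set = B′ ; indep = ¬evB′ ; large = A<B′ ; ⊆∪ = ⊆∪
            ; ⊇ = λ { f (here refl) _ → e∈B′ ; f (there p) → ⊇ f p } }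
    ... | yes e∈A | no e∉B′ with hasEven? (insertₑ e B′)
    ...   | no ¬ev = record
            { set   = insertₑ e B′
            ; indep = ¬ev
            ; large = ≤-trans A<B′ (card-mono {A = B′} {insertₑ e B′} (⊆-insert e B′))
            ; ⊆∪    = ∪
            ; ⊇     = λ { f (here refl) _ → ∈-insert e B′ ; f (there p) q → ⊆-insert e B′ f (⊇ f p q) }
            }
            where
            ∪ : ∀ f → f ∈ₑ insertₑ e B′ → f ∈ₑ A ⊎ f ∈ₑ B
            ∪ f p with insert⁻ e B′ {f} p
            ... | inj₁ q    = ⊆∪ f q
            ... | inj₂ refl = inj₁ e∈A
    -- `A` has no nonempty even subset, so `Z` leaves `A` and the edge given up for `e` can be
    -- chosen outside `A`. The size stays the same, and no edge of `A` already gained is lost.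
    ...   | yes (Z , Z⊆ , evZ , g , g∈Z) with f , f∈Z , f∉A ← ⊈⇒∃ {A = Z} {A} (λ Z⊆A → ¬evA (Z , Z⊆A , evZ , g , g∈Z)) = record
            { set   = remove f (insertₑ e B′)
            ; indep = fundamental-exchange {B = B′} {Z} {e} {f} ¬evB′ Z⊆ evZ f∈Z
            ; large = subst (card A <_) (suc-injective (trans (sym (card-insert {e = e} {B′} (≢true⇒≡false e∉B′)))
                        (sym (card-remove f (insertₑ e B′) (Z⊆ f f∈Z))))) A<B′
            ; ⊆∪    = ∪
            ; ⊇     = λ { h (here refl) q → remove⁺ f (insertₑ e B′) {h} (∈-insert e B′) λ { refl → f∉A q }
                        ; h (there p) q → remove⁺ f (insertₑ e B′) {h} (⊆-insert e B′ h (⊇ h p q)) λ { refl → f∉A q } }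
            }
            where
            ∪ : ∀ h → h ∈ₑ remove f (insertₑ e B′) → h ∈ₑ A ⊎ h ∈ₑ B
            ∪ h p with insert⁻ e B′ {h} (proj₁ (remove⁻ f (insertₑ e B′) {h} p))
            ... | inj₁ q    = ⊆∪ h q
            ... | inj₂ refl = inj₁ e∈A

  -- The set reached by the exchanges contains `A` and is larger. Any further edge of it comes from
  -- `B`, and adding it to `A` stays inside a set already known to be independent.
  evenFree-aug : ∃[ e ] (e ∈ₑ B × ¬ (e ∈ₑ A) × ¬ HasEven (insertₑ e A))
  evenFree-aug with record { set = B′ ; indep = ¬evB′ ; large = A<B′ ; ⊆∪ = ⊆∪ ; ⊇ = ⊇ } ← exchange (allEdges n)
    with e , e∈B′ , e∉A ← card<⇒∃ {A = A} {B′} A<B′ =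
    e , (case ⊆∪ e e∈B′ of λ { (inj₁ p) → ⊥-elim (e∉A p) ; (inj₂ p) → p }) , e∉A ,
    ¬evB′ ∘ HasEven-mono {A = insertₑ e A} {B′} (insert-⊆ {e = e} {A} {B′} e∈B′ λ f → ⊇ f (∈-allEdges f))

graphic : ∀ n → Matroid n
graphic n = record
  { Indep     = λ A → ¬ HasEven A
  ; indep-∅   = λ (_ , D⊆ , _ , e , e∈D) → case D⊆ e e∈D of λ ()
  ; indep-⊆   = λ A B A⊆B ¬ev → ¬ev ∘ HasEven-mono {A = A} {B} A⊆B
  ; indep-aug = λ A B → evenFree-aug {A = A} {B}
  }

graphic-IsCk : ∀ n m → IsCkMatroid (3 + m) (graphic n)
graphic-IsCk n m S ck with a , b , c , r , u , _ , eq ← IsCkSet⇒cycleSet ck =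
  (λ ¬ev → ¬ev (S , (λ _ p → p) , Even-IsCkSet ck , e , trans (eq e) (trans (cycleSet≐ u e ee e) (∈-insert e (pathSet (a ∷ b ∷ c ∷ r)))))) ,
  λ D D⊆S (f , f∈S , f∉D) (D′ , D′⊆ , ev , g , g∈D′) →
    cycleSet-minimal u {D′} {f} (λ h p → trans (sym (eq h)) (D⊆S h (D′⊆ h p))) (trans (sym (eq f)) f∈S) (f∉D ∘ D′⊆ f) ev g g∈D′
  where
  e  = proj₁ (closingEdge u)
  ee = proj₂ (closingEdge u)

-- The sparse paving matroid of rank k whose circuit-hyperplanes are the k-cycles

module _ (n m : ℕ) where

  private
    k = 3 + m
    I : ESet n → Set
    I A = card A ≤ k × ¬ IsCkSet k A

  paving : Matroid n
  paving = record
    { Indep     = I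
    ; indep-∅   = subst (_≤ k) (sym (card-∅ {n})) z≤n , λ ck → case trans (sym (card-∅ {n})) (card-IsCkSet ck) of λ ()
    -- A k-cycle inside `B` already has k edges, hence equals `B`.
    ; indep-⊆   = λ A B A⊆B (B≤k , ¬ck) → ≤-trans (card-mono {A = A} {B} A⊆B) B≤k , λ ck →
        ¬ck (IsCkSet-cong (⊆-antisym {A = A} {B} A⊆B
          (⊆∧card≥⇒⊇ {A = A} {B} A⊆B (≤-trans B≤k (≤-reflexive (sym (card-IsCkSet ck)))))) ck)
    ; indep-aug = aug
    }
    where
    aug : ∀ A B → I A → I B → card A < card B → ∃[ e ] (e ∈ₑ B × ¬ (e ∈ₑ A) × I (insertₑ e A))
    aug A B _ (B≤k , ¬ckB) A<B
      with e , e∈B , e∉A ← card<⇒∃ {A = A} {B} A<B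
      -- Either `A` plus `e` is `B` itself, by size, or it is not even and so no k-cycle. Otherwise
      -- `B` has an edge `f` outside it, and `A` plus `f` cannot be even as well.
      with B ⊆ₑ? insertₑ e A | FP.all? (λ x → par x (insertₑ e A) BP.≟ false)
    ... | yes B⊆ | _ = e , e∈B , e∉A , ≤-trans (card-mono {A = insertₑ e A} {B} ⊆B) B≤k ,
            λ ck → ¬ckB (IsCkSet-cong (⊆-antisym {A = insertₑ e A} {B} ⊆B B⊆) ck)
      where
      ⊆B : insertₑ e A ⊆ₑ B
      ⊆B = ⊆∧card≥⇒⊇ {A = B} {insertₑ e A} B⊆ (subst (_≤ card B) (sym (card-insert {e = e} {A} (≢true⇒≡false e∉A))) A<B)
    ... | no _ | no ¬ev = e , e∈B , e∉A ,
            subst (_≤ k) (sym (card-insert {e = e} {A} (≢true⇒≡false e∉A))) (≤-trans A<B B≤k) , ¬ev ∘ Even-IsCkSet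
    ... | no B⊈ | yes ev with f , f∈B , f∉ ← ⊈⇒∃ {A = B} {insertₑ e A} B⊈ =
            f , f∈B , f∉A ,
            subst (_≤ k) (sym (card-insert {e = f} {A} (≢true⇒≡false f∉A))) (≤-trans A<B B≤k) ,
            λ ck → f∉ (subst (λ g → f ∈ₑ insertₑ g A)
              (sym (Even-insert-injective {A = A} {e} {f} (≢true⇒≡false e∉A) (≢true⇒≡false f∉A) ev (Even-IsCkSet ck)))
              (∈-insert f A))
      where
      f∉A : ¬ (f ∈ₑ A)
      f∉A = f∉ ∘ ⊆-insert e A f

  paving-IsCk : IsCkMatroid k paving
  paving-IsCk S ck = (λ (_ , ¬ck) → ¬ck ck) , λ D D⊆S (e , e∈S , e∉D) →
    let D<k = subst (card D <_) (card-IsCkSet ck) (card-strict {A = D} {S} {e} D⊆S e∈S e∉D)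
    in ≤-trans (n≤1+n _) D<k , λ ckD → <⇒≱ D<k (≤-reflexive (sym (card-IsCkSet ckD)))

-- Completing a relation along Hamiltonian paths

module _ {V : Set} (R : V → V → Set) where

  data Path : V → List V → V → Set where
    [_] : ∀ a → Path a (a ∷ []) a
    _∷_ : ∀ {a b l z} → R a b → Path b l z → Path a (a ∷ l) z

  join : ∀ {a l z b l′ y} → Path a l z → R z b → Path b l′ y → Path a (l ++ l′) y
  join [ _ ]   r q = r ∷ q
  join (s ∷ p) r q = s ∷ join p r q

  -- A Hamiltonian cycle through a, up to its closing edge, together with the chord that bypasses a.
  Wheel : List V → Set
  Wheel []      = ⊥
  Wheel (a ∷ l) = Σ V λ x → Σ V λ z → Path x l z × R a x × R z x

  module _ (R-sym : ∀ {x y} → R x y → R y x) (R-refl : ∀ {x} → R x x)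
           {W : List V} (close : ∀ {a l z} → Path a l z → l ↭ W → R z a) where

    private
      -- Run from `m` to `z`, cross to `x`, continue to `m′` and end at `a`: closing this
      -- Hamiltonian path relates `a` to `m`, the vertex after `m′`. The relation thus spreads along
      -- the rim.
      hub-step : ∀ {a x q m′ m ys z} → Path x q m′ → R m′ m → Path m ys z → R z x → R a m′ →
        a ∷ q ++ ys ↭ W → All (R a) ys
      hub-step {a} {x} {q} {m′} {m} {ys} {z} Q r P zx am′ perm = extend P am perm
        where
        am : R a m
        am = close (join P zx (join Q (R-sym am′) [ a ]))
          (↭-trans (++-comm ys (q ++ a ∷ [])) (↭-trans (↭-reflexive (++-assoc q (a ∷ []) ys)) (↭-trans (shift a q ys) perm)))
        extend : ∀ {ys} → Path m ys z → R a m → a ∷ q ++ ys ↭ W → All (R a) ys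
        extend [ _ ] am _ = am ∷ []
        extend (_∷_ {l = l} s P) am perm = am ∷ hub-step (join Q r [ m ]) s P zx am
          (↭-trans (prep a (↭-reflexive (++-assoc q (m ∷ []) l))) perm)

    hub : ∀ {a l} → Wheel (a ∷ l) → a ∷ l ↭ W → All (R a) l
    hub (x , _ , [ _ ]   , ax , zx) perm = ax ∷ []
    hub (x , _ , (r ∷ P) , ax , zx) perm = ax ∷ hub-step [ x ] r P zx ax perm

    -- The next rim vertex `x` becomes the hub, and `a` joins the end of the rim y ... z. The new
    -- rim edges come from closing a x y ... z and y ... z x a.
    rotate : ∀ {a l} → Wheel (a ∷ l) → a ∷ l ↭ W → Wheel (l ++ a ∷ [])
    rotate {a} (x , _ , [ _ ] , ax , _) _ = a , a , [ a ] , R-sym ax , R-refl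
    rotate {a} (x , z , (_∷_ {b = y} {l = l} xy P) , ax , zx) perm =
      y , a , join P (close (ax ∷ (xy ∷ P)) perm) [ a ] , xy ,
      close (join P zx (R-sym ax ∷ [ a ])) (↭-trans (++-comm l (x ∷ a ∷ [])) (↭-trans (swap x a refl) perm))

    rotate* : ∀ xs ys → Wheel (xs ++ ys) → xs ++ ys ↭ W → Wheel (ys ++ xs)
    rotate* []       ys w _    = subst Wheel (sym (++-identityʳ ys)) w
    rotate* (x ∷ xs) ys w perm = subst Wheel (++-assoc ys (x ∷ []) xs)
      (rotate* xs (ys ++ x ∷ []) (subst Wheel (++-assoc xs ys (x ∷ [])) (rotate w perm))
        (↭-trans (↭-reflexive (sym (++-assoc xs ys (x ∷ [])))) (↭-trans (↭-sym (∷↭∷ʳ x (xs ++ ys))) perm)))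

    -- Rotation makes any vertex `p` the hub, and the hub is related to all the others.
    complete : Wheel W → ∀ {p q} → p ∈ W → q ∈ W → R p q
    complete w p∈ q∈ with xs , ys , refl ← ∈-∃++ p∈ =
      case ∈-resp-↭ (++-comm xs (_ ∷ ys)) q∈ of λ where
        (here refl) → R-refl
        (there q∈′) → All.lookup (hub (rotate* xs _ w refl) (++-comm (_ ∷ ys) xs)) q∈′

Unique-resp-↭ : {V : Set} {l l′ : List V} → l ↭ l′ → Unique l → Unique l′
Unique-resp-↭ {V} perm = PermS.Unique-resp-↭ (setoid V) (↭⇒↭ₛ perm)

-- Matroids above the sparse paving matroid have rank k

module _ {n p : ℕ} (M : Matroid n) (ck : IsCkMatroid (5 + p) M) (above : paving n (2 + p) ≼ M) where

  private
    k = 5 + p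

    small : ∀ A → card A < k → Indep M A
    small A A<k = above A (≤-trans (n≤1+n _) A<k , λ c → <⇒≱ A<k (≤-reflexive (sym (card-IsCkSet c))))

    -- Membership in the closure of an independent `B`; the guard makes the edges of `B` itself
    -- count as spanned.
    Spans : ESet n → Edge n → Set
    Spans B e = B e ≡ false → ¬ Indep M (insertₑ e B)

    -- An independent set of size k. That such a set is a basis of `M` amounts to the rank bound
    -- still to be proved.
    IsBasis : ESet n → Set
    IsBasis B = card B ≡ k × Indep M B

    ∈⇒Spans : ∀ B {e} → e ∈ₑ B → Spans B e
    ∈⇒Spans B e∈ e∉ = ⊥-elim (true≢false e∈ e∉)

    card-insert-basis : ∀ {B e} → IsBasis B → B e ≡ false → card (insertₑ e B) ≡ suc k
    card-insert-basis {B} {e} (B≡k , _) e∉ = trans (card-insert {e = e} {B} e∉) (cong suc B≡k)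

    -- A larger independent set would augment `B` by an edge that `B` spans.
    noAugmentation : ∀ {B A} → IsBasis B → (∀ e → e ∈ₑ A → Spans B e) → Indep M A → ¬ (k < card A)
    noAugmentation {B} {A} (B≡k , iB) sp iA k<A
      with e , e∈A , e∉B , i ← indep-aug M B A iB iA (subst (_< card A) (sym B≡k) k<A) = sp e e∈A (≢true⇒≡false e∉B) i

    -- `B` and `Z` have equal size. If `B` plus `e` were independent, it would be a set of k + 1
    -- edges in the closure of `Z`.
    Spans-trans : ∀ {B Z} → IsBasis B → IsBasis Z → (∀ e → e ∈ₑ B → Spans Z e) → ∀ e → Spans Z e → Spans B e
    Spans-trans {B} {Z} bB bZ B⊆Z e e∈Z e∉B i = noAugmentation {Z} {insertₑ e B} bZ
      (λ f p → case insert⁻ e B {f} p of λ { (inj₁ q) → B⊆Z f q ; (inj₂ refl) → e∈Z })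
      i (≤-reflexive (sym (card-insert-basis {B} {e} bB e∉B)))

    -- Suppose `B` plus `e` is independent. Augment the k - 1 edges of `P` from it twice. Neither
    -- new edge is `e`, because `P` plus `e` is a k-cycle and so dependent; hence both lie in `B`.
    -- The result is an independent set of k + 1 edges spanned by `B`, which is too large.
    Spans-cycle : ∀ {B P} e → IsBasis B → card P ≡ 4 + p → (∀ f → f ∈ₑ P → Spans B f) →
      IsCkSet k (insertₑ e P) → Spans B e
    Spans-cycle {B} {P} e bB P≡ P⊆ c e∉B i = contra
      where
      Be = insertₑ e B
      Be≡ : card Be ≡ suc k
      Be≡ = card-insert-basis {B} {e} bB e∉B
      P<Be : card P < card Be
      P<Be = ≤-trans (≤-reflexive (cong suc P≡)) (≤-trans (n≤1+n k) (≤-reflexive (sym Be≡)))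
      card+1 : ∀ f → ¬ (f ∈ₑ P) → card (insertₑ f P) ≡ k
      card+1 f f∉P = trans (card-insert {e = f} {P} (≢true⇒≡false f∉P)) (cong suc P≡)
      old : ∀ f → f ∈ₑ Be → f ≢ e → f ∈ₑ B
      old f f∈ f≢e with insert⁻ e B {f} f∈
      ... | inj₁ q = q
      ... | inj₂ q = ⊥-elim (f≢e q)
      contra : ⊥
      contra
        with f , f∈ , f∉P , iPf ← indep-aug M P Be (small P (≤-reflexive (cong suc P≡))) i P<Be
        with g , g∈ , g∉Pf , iPfg ← indep-aug M (insertₑ f P) Be iPf i (≤-reflexive (trans (cong suc (card+1 f f∉P)) (sym Be≡)))
        = noAugmentation {B} {insertₑ g (insertₑ f P)} bB
            (λ h q → case insert⁻ g (insertₑ f P) {h} q of λ where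
              (inj₂ refl) → ∈⇒Spans B {h} (old g g∈ λ { refl → proj₁ (ck _ c)
                (indep-⊆ M (insertₑ e P) (insertₑ e (insertₑ f P)) (insert-mono e {P} {insertₑ f P} (⊆-insert f P)) iPfg) })
              (inj₁ q′)   → case insert⁻ f P {h} q′ of λ where
                (inj₂ refl) → ∈⇒Spans B {h} (old f f∈ λ { refl → proj₁ (ck _ c) iPf })
                (inj₁ q″)   → P⊆ h q″)
            iPfg (≤-reflexive (sym (trans (card-insert {e = g} {insertₑ f P} (≢true⇒≡false g∉Pf)) (cong suc (card+1 f f∉P)))))

    Rel : ESet n → Fin n → Fin n → Set
    Rel B x y = ∀ f → EndsAt f x y → Spans B f

    Rel-sym : ∀ B {x y} → Rel B x y → Rel B y x
    Rel-sym B r f fe = r f (EndsAt-sym f fe)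

    Rel-refl : ∀ B {x} → Rel B x x
    Rel-refl B f fe = ⊥-elim (EndsAt-irrefl f fe)

    toPath : ∀ {B} a r → (∀ f → f ∈ₑ pathSet (a ∷ r) → Spans B f) → Path (Rel B) a (a ∷ r) (lastOf a r)
    toPath a []      sp = [ a ]
    toPath a (b ∷ r) sp = (λ f fe → sp f (∨⁺ʳ (pathSet (b ∷ r) f) (link⁺ f fe))) ∷ toPath b r (λ f q → sp f (∨⁺ˡ q))

    fromPath : ∀ {B a l z} → Path (Rel B) a l z →
      Σ (List (Fin n)) λ r → l ≡ a ∷ r × lastOf a r ≡ z × (∀ f → f ∈ₑ pathSet (a ∷ r) → Spans B f)
    fromPath [ a ] = [] , refl , refl , λ _ ()
    fromPath (_∷_ {a = a} {b} s P) with r , refl , eq , sp ← fromPath P = b ∷ r , refl , eq , λ f q →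
      case ∨⁻ (pathSet (b ∷ r) f) q of λ { (inj₁ q′) → sp f q′ ; (inj₂ q′) → s f (link⁻ f q′) }

    Rel-close : ∀ {B W} → IsBasis B → Unique W → length W ≡ k →
      ∀ {a l z} → Path (Rel B) a l z → l ↭ W → Rel B z a
    Rel-close {B} bB uW lW {a} P perm f fe with fromPath P
    ... | r , refl , refl , sp = go r fe sp (Unique-resp-↭ (↭-sym perm) uW) (trans (↭-length perm) lW)
      where
      go : ∀ r → EndsAt f (lastOf a r) a → (∀ f → f ∈ₑ pathSet (a ∷ r) → Spans B f) →
        Unique (a ∷ r) → length (a ∷ r) ≡ k → Spans B f
      go (b ∷ c ∷ r) fe sp u len = Spans-cycle {B} {pathSet (a ∷ b ∷ c ∷ r)} f bB
        (trans (card-pathSet a _ u) (suc-injective len)) sp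
        (IsCkSet-cong (cycleSet≐ u f fe) (subst (λ t → IsCkSet t (cycleSet a (b ∷ c ∷ r))) len (cycleSet-IsCkSet a _ u)))

  -- One set of size k that spans every edge

  module _ {z₀ a b c d : Fin n} {r : List (Fin n)} (u₀ : Unique (z₀ ∷ a ∷ b ∷ c ∷ d ∷ r)) (len : length r ≡ p) where

    private
      u : Unique (a ∷ b ∷ c ∷ d ∷ r)
      u = AllPairs.tail u₀
      rim : List (Fin n)
      rim = a ∷ b ∷ c ∷ d ∷ r
      Cyc : ESet n
      Cyc = cycleSet a (b ∷ c ∷ d ∷ r)

      -- `Cyc` is even, so one more edge spoils the parity at its ends. The result has k edges and
      -- is no k-cycle, hence is independent already in the sparse paving matroid.
      insert-basis : ∀ {e} → Cyc e ≡ false → IsBasis (insertₑ e Cyc)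
      insert-basis {e} e∉ = eq , above _ (≤-reflexive eq , ¬Even-insert {A = Cyc} (Even-cycleSet u) {e} e∉ ∘ Even-IsCkSet)
        where
        eq : card (insertₑ e Cyc) ≡ k
        eq = trans (card-insert {e = e} {Cyc} e∉) (cong suc (trans (card-cycleSet u) (cong (4 +_) len)))

      chord : ∃[ e ] EndsAt e a c
      chord = edgeBetween (All.head (All.tail (AllPairs.head u)))

      -- A rim of at least four vertices, that is k ≥ 5, keeps `c` away from both neighbours of `a`
      -- on the cycle.
      chord∉ : Cyc (proj₁ chord) ≡ false
      chord∉ = ≢true⇒≡false λ p → case ∨⁻ (pathSet rim e) p of λ where
          (inj₂ q) → All.lookup (AllPairs.head (AllPairs.tail (AllPairs.tail u))) (lastOf-∈ d r)
                       (EndsAt-cancel e ee (EndsAt-sym e (link⁻ e q)))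
          (inj₁ q) → case ∨⁻ (pathSet (b ∷ c ∷ d ∷ r) e) q of λ where
            (inj₁ q′) → true≢false q′ (∉-pathSet e ee (AllPairs.head u))
            (inj₂ q′) → All.head (AllPairs.head (AllPairs.tail u)) (EndsAt-cancel e (link⁻ e q′) ee)
        where
        e  = proj₁ chord
        ee = proj₂ chord

      B : ESet n
      B = insertₑ (proj₁ chord) Cyc

      bB : IsBasis B
      bB = insert-basis chord∉

      Cyc-path : ∀ e → Path (Rel (insertₑ e Cyc)) a rim (lastOf d r)
      Cyc-path e = toPath a _ λ f p → ∈⇒Spans (insertₑ e Cyc) {f} (⊆-insert e Cyc f (∨⁺ˡ p))

      -- `Z` changes with `z` but `B` does not: passing from `Z` to `B` gathers the edges obtained
      -- for the different outer vertices in the span of a single set.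
      Rel-B : ∀ {z} → All (z ≢_) rim → ∀ {x y} → x ∈ z ∷ rim → y ∈ z ∷ rim → Rel B x y
      Rel-B {z} z# x∈ y∈ f fe = Spans-trans {B} {Z} bB bZ B⊆Z f (Rel-Z x∈ y∈ f fe)
        where
        spoke = edgeBetween (All.head z#)
        e  = proj₁ spoke
        ee = proj₂ spoke
        Z = insertₑ e Cyc
        bZ : IsBasis Z
        bZ = insert-basis (≢true⇒≡false λ p → All.lookup z# (EndsAt-∈-cycle e (b ∷ c ∷ d ∷ r) ee p) refl)
        wheel : Wheel (Rel Z) (z ∷ rim)
        wheel = a , lastOf d r , Cyc-path e ,
          (λ f fe → ∈⇒Spans Z {f} (subst (_∈ₑ Z) (EndsAt-unique {e = e} {f} ee fe) (∈-insert e Cyc))) ,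
          λ f fe → ∈⇒Spans Z {f} (⊆-insert e Cyc f (∨⁺ʳ (pathSet rim f) (link⁺ f fe)))
        Rel-Z : ∀ {x y} → x ∈ z ∷ rim → y ∈ z ∷ rim → Rel Z x y
        Rel-Z = complete (Rel Z) (Rel-sym Z) (Rel-refl Z) (Rel-close {Z} bZ (z# ∷ u) (cong (5 +_) len)) wheel
        B⊆Z : ∀ f → f ∈ₑ B → Spans Z f
        B⊆Z f p with insert⁻ (proj₁ chord) Cyc {f} p
        ... | inj₁ q    = ∈⇒Spans Z {f} (⊆-insert e Cyc f q)
        ... | inj₂ refl = Rel-Z (there (here refl)) (there (there (there (here refl)))) _ (proj₂ chord)

      B-spans : ∀ x y → Rel B x y
      B-spans x y with Any.any? (x ≟_) rim | Any.any? (y ≟_) rim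
      ... | yes x∈ | yes y∈ = Rel-B (AllPairs.head u₀) (there x∈) (there y∈)
      ... | yes x∈ | no  y∉ = Rel-B (All.tabulate λ q eq → y∉ (subst (_∈ rim) (sym eq) q)) (there x∈) (here refl)
      ... | no  x∉ | yes y∈ = Rel-B (All.tabulate λ q eq → x∉ (subst (_∈ rim) (sym eq) q)) (here refl) (there y∈)
      ... | no  x∉ | no  y∉ with x ≟ y
      ...   | yes refl = Rel-refl B
      -- The path y b c d ... x leaves out `a` to make room for two outer vertices, so it again has
      -- k vertices and closes to a k-cycle.
      ...   | no x≢y = Rel-close {B} bB ((x≢y ∷ All.tail x#) ∷ All.tail y# ∷ AllPairs.tail u) (cong (5 +_) len)
          (Rel-B y# (here refl) (there (there (here refl))) ∷
            join (Rel B) (tailPath (Cyc-path (proj₁ chord))) (Rel-B x# (there (lastOf-∈ a _)) (here refl)) [ x ])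
          (↭-sym (∷↭∷ʳ x (y ∷ b ∷ c ∷ d ∷ r)))
        where
        x# : All (x ≢_) rim
        x# = All.tabulate λ q eq → x∉ (subst (_∈ rim) (sym eq) q)
        y# : All (y ≢_) rim
        y# = All.tabulate λ q eq → y∉ (subst (_∈ rim) (sym eq) q)
        tailPath : ∀ {l z} → Path (Rel B) a (a ∷ b ∷ l) z → Path (Rel B) b (b ∷ l) z
        tailPath (_ ∷ P@([ _ ])) = P
        tailPath (_ ∷ P@(_ ∷ _)) = P

    card-bounded : ∀ A → Indep M A → card A ≤ k
    card-bounded A iA = ≮⇒≥ (noAugmentation {B} {A} bB (λ e _ → B-spans _ _ e (inj₁ (refl , refl))) iA)

private variable k : ℕ

-- Deciding whether a family of edge sets is a C_k-matroid

anyFun? : ∀ k {P : (Fin k → Fin n) → Set} → (∀ {f g} → f ≗ g → P f → P g) → (∀ f → Dec (P f)) → Dec (∃ P)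
anyFun? zero    ext P? = map′ (VF.[] ,_) (λ (f , p) → ext (λ ()) p) (P? VF.[])
anyFun? (suc k) ext P? = map′
  (λ (a , g , p) → a VF.∷ g , p)
  (λ (f , p) → f zero , f ∘ suc , ext (λ { zero → refl ; (suc i) → refl }) p)
  (FP.any? λ a → anyFun? k (λ eq → ext λ { zero → refl ; (suc i) → eq i }) (λ g → P? (a VF.∷ g)))

isCkSet? : ∀ k (S : ESet n) → Dec (IsCkSet k S)
isCkSet? {n} k S = anyFun? k resp λ v → injective? v ×-dec allEdge? λ e →
  map′ (λ (f , g) → mk⇔ f g) (λ h → to h , from h)
    (((S e BP.≟ true) →-dec cycleEdge? v e) ×-dec (cycleEdge? v e →-dec (S e BP.≟ true)))
  where
  open Equivalence
  cycleEdge? : (v : Fin k → Fin n) (e : Edge n) → Dec (∃[ t ] EndsAt e (v t) (v (nextFin t)))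
  cycleEdge? v e = FP.any? λ t → endsAt? e (v t) (v (nextFin t))
  injective? : (v : Fin k → Fin n) → Dec (Injective _≡_ _≡_ v)
  injective? v = map′ (λ p {i} {j} → p i j) (λ p i j → p) (FP.all? λ i → FP.all? λ j → (v i ≟ v j) →-dec (i ≟ j))
  resp : ∀ {v w : Fin k → Fin n} → v ≗ w →
    Injective _≡_ _≡_ v × (∀ e → e ∈ₑ S ⇔ (∃[ t ] EndsAt e (v t) (v (nextFin t)))) →
    Injective _≡_ _≡_ w × (∀ e → e ∈ₑ S ⇔ (∃[ t ] EndsAt e (w t) (w (nextFin t))))
  resp {v} {w} v≗w (inj , iff) =
    (λ {i} {j} eq → inj (trans (v≗w i) (trans eq (sym (v≗w j))))) , λ e →
    mk⇔ (λ p → let t , q = to (iff e) p in t , move e (v≗w t) (v≗w (nextFin t)) q)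
        (λ (t , q) → from (iff e) (t , move e (sym (v≗w t)) (sym (v≗w (nextFin t))) q))
    where
    move : ∀ e {a b c d} → a ≡ c → b ≡ d → EndsAt e a b → EndsAt e c d
    move e refl refl q = q

-- The axioms are separated from the predicate and live in `Set`, so that they can be decided for
-- each listed family; `Matroid` bundles an arbitrary predicate and lives in `Set₁`.
record CkAxioms (k : ℕ) (I : ESet n → Set) : Set where
  field
    ∅-ax    : I ∅ₑ
    ⊆-ax    : ∀ A B → A ⊆ₑ B → I B → I A
    aug-ax  : ∀ A B → I A → I B → card A < card B → ∃[ e ] (e ∈ₑ B × ¬ (e ∈ₑ A) × I (insertₑ e A))
    circ-ax : ∀ S → IsCkSet k S → ¬ I S × (∀ D → D ⊆ₑ S → (∃[ e ] (e ∈ₑ S × ¬ (e ∈ₑ D))) → I D)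
open CkAxioms

toMatroid : {I : ESet n → Set} → CkAxioms k I → Matroid n
toMatroid {I = I} ax = record { Indep = I ; indep-∅ = ∅-ax ax ; indep-⊆ = ⊆-ax ax ; indep-aug = aug-ax ax }

fromMatroid : {M : Matroid n} → IsCkMatroid k M → CkAxioms k (Indep M)
fromMatroid {M = M} ck = record { ∅-ax = indep-∅ M ; ⊆-ax = indep-⊆ M ; aug-ax = indep-aug M ; circ-ax = ck }

CkAxioms-resp : {I J : ESet n → Set} → (∀ A → I A → J A) → (∀ A → J A → I A) → CkAxioms k I → CkAxioms k J
CkAxioms-resp f g ax = record
  { ∅-ax    = f _ (∅-ax ax)
  ; ⊆-ax    = λ A B A⊆B b → f A (⊆-ax ax A B A⊆B (g B b))
  ; aug-ax  = λ A B a b lt → let e , e∈ , e∉ , i = aug-ax ax A B (g A a) (g B b) lt in e , e∈ , e∉ , f _ i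
  ; circ-ax = λ S c → let ¬i , h = circ-ax ax S c in ¬i ∘ g S , λ D D⊆ e → f D (h D D⊆ e)
  }

ckAxioms? : ∀ k {I : ESet n → Set} → Extensional I → (∀ A → Dec (I A)) → Dec (CkAxioms k I)
ckAxioms? {n} k {I} ext I? = map′
  (λ (a , b , c , d) → record { ∅-ax = a ; ⊆-ax = b ; aug-ax = c ; circ-ax = d })
  (λ ax → ∅-ax ax , ⊆-ax ax , aug-ax ax , circ-ax ax)
  -- The first argument of every `allESet?` shows that the tested property respects `_≐_`; the
  -- second decides it.
  (I? ∅ₑ
   ×-dec allESet?
     (λ {A} {A′} eq p B A′⊆B b → ext eq (p B (λ e q → A′⊆B e (≐⇒⊆ {A = A} {A′} eq e q)) b))
     (λ A → allESet?
       (λ {B} {B′} eq p A⊆B′ b → p (λ e q → trans (eq e) (A⊆B′ e q)) (ext (≐-sym eq) b))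
       λ B → (A ⊆ₑ? B) →-dec (I? B →-dec I? A))
   ×-dec allESet?
     (λ {A} {A′} eq p B a b lt →
       let e , e∈ , e∉ , i = p B (ext (≐-sym eq) a) b (subst (_< card B) (sym (card-cong eq)) lt) in
       e , e∈ , (λ q → e∉ (trans (eq e) q)) , ext (λ f → cong (_∨ (f ==ₑ e)) (eq f)) i)
     (λ A → allESet?
       (λ {B} {B′} eq p a b lt →
         let e , e∈ , rest = p a (ext (≐-sym eq) b) (subst (card A <_) (sym (card-cong eq)) lt) in
         e , trans (sym (eq e)) e∈ , rest)
       λ B → I? A →-dec (I? B →-dec ((card A <? card B) →-dec
         anyEdge? λ e → (B e BP.≟ true) ×-dec ¬? (A e BP.≟ true) ×-dec I? (insertₑ e A))))
   ×-dec allESet?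
     (λ {S} {S′} eq p c → let ¬i , h = p (IsCkSet-cong (≐-sym eq) c) in
       (λ i → ¬i (ext (≐-sym eq) i)) ,
       λ D D⊆ (e , e∈ , e∉) → h D (λ f q → trans (eq f) (D⊆ f q)) (e , trans (eq e) e∈ , e∉))
     (λ S → isCkSet? k S →-dec (¬? (I? S) ×-dec allESet?
       (λ {D} {D′} eq p D′⊆ (e , e∈ , e∉) →
         ext eq (p (λ f q → D′⊆ f (trans (sym (eq f)) q)) (e , e∈ , λ q → e∉ (trans (sym (eq e)) q))))
       λ D → (D ⊆ₑ? S) →-dec (anyEdge? (λ e → (S e BP.≟ true) ×-dec ¬? (D e BP.≟ true)) →-dec I? D))))

-- Maximal C_k-matroids above a given one

module _ {X : Set} {Good : X → Set} {_⊑_ : X → X → Set}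
  (good? : ∀ x → Dec (Good x)) (_⊑?_ : ∀ x y → Dec (x ⊑ y))
  (⊑-refl : ∀ {x} → x ⊑ x) (⊑-trans : ∀ {x y z} → x ⊑ y → y ⊑ z → x ⊑ z) where

  -- One pass suffices. An accepted candidate lies below the final element. A rejected good one does
  -- not lie above the current element, hence not above the final one either.
  maximalIn : ∀ xs x → Good x → ∃[ y ] (Good y × x ⊑ y × (∀ {w} → w ∈ xs → Good w → y ⊑ w → w ⊑ y))
  maximalIn [] x g = x , g , ⊑-refl , λ ()
  maximalIn (w ∷ xs) x g with good? w ×-dec (x ⊑? w)
  ... | yes (gw , x⊑w) = let y , gy , w⊑y , max = maximalIn xs w gw in
    y , gy , ⊑-trans x⊑w w⊑y , λ { (here refl) _ _ → w⊑y ; (there p) → max p }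
  ... | no ¬p = let y , gy , x⊑y , max = maximalIn xs x g in
    y , gy , x⊑y , λ { (here refl) gw y⊑w → ⊥-elim (¬p (gw , ⊑-trans x⊑y y⊑w)) ; (there p) → max p }

-- Each single instance of excluded middle is irrefutable, and the finite list lets them be
-- combined.
¬¬-decide : {X : Set} {P : X → Set} (xs : List X) → ¬ ¬ All (Dec ∘ P) xs
¬¬-decide []       h = h []
¬¬-decide (x ∷ xs) h = ¬¬-decide xs λ ds → h (no (λ p → h (yes p ∷ ds)) ∷ ds)

private
  -- The family presented by a list, closed under `_≐_`; membership in it is decidable.
  ⟦_⟧ : List (ESet n) → ESet n → Set
  ⟦ F ⟧ A = Any (A ≐_) F

  ⟦⟧-ext : (F : List (ESet n)) → Extensional ⟦ F ⟧
  ⟦⟧-ext F eq = Any.map (λ eq′ e → trans (sym (eq e)) (eq′ e))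

  ⟦⟧? : (F : List (ESet n)) (A : ESet n) → Dec (⟦ F ⟧ A)
  ⟦⟧? F A = Any.any? (λ B → allEdge? λ e → A e BP.≟ B e) F

  module _ {I : ESet n → Set} (ext : Extensional I) (I? : ∀ A → Dec (I A)) where

    family : List (ESet n)
    family = filter I? (allESets n)

    family⁺ : ∀ A → I A → ⟦ family ⟧ A
    family⁺ A i = let B , B∈ , eq = find (∈-allESets A) in lose (∈-filter⁺ I? B∈ (ext eq i)) eq

    family⁻ : ∀ A → ⟦ family ⟧ A → I A
    family⁻ A p = let B , B∈ , eq = find p in ext (≐-sym eq) (proj₂ (∈-filter⁻ I? {xs = allESets n} B∈))

  Indep-ext : (M : Matroid n) → Extensional (Indep M)
  Indep-ext M {A} {B} eq = indep-⊆ M B A (≐⇒⊆ {A = B} {A} (≐-sym eq))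

-- The decision procedure turns `M` into a listed family, from which the climb starts.
maximalAbove : (M : Matroid n) → (∀ A → Dec (Indep M A)) → IsCkMatroid k M →
  Σ (Matroid n) λ N → IsMaximalCkMatroid k N × M ≼ N
maximalAbove {n} {k} M I? ck = conclude (maximalIn
    (λ F → ckAxioms? k (⟦⟧-ext F) (⟦⟧? F))
    (λ F G → allESet? (λ eq p q → ⟦⟧-ext G eq (p (⟦⟧-ext F (≐-sym eq) q))) λ A → ⟦⟧? F A →-dec ⟦⟧? G A)
    (λ _ p → p) (λ p q A → q A ∘ p A)
    (sublists (allESets n)) (family (Indep-ext M) I?)
    (CkAxioms-resp (family⁺ (Indep-ext M) I?) (family⁻ (Indep-ext M) I?) (fromMatroid {M = M} ck)))
  where
  _⊑_ : List (ESet n) → List (ESet n) → Set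
  F ⊑ G = ∀ A → ⟦ F ⟧ A → ⟦ G ⟧ A

  -- M′ need not be decidable, but membership in F is, so M′ may be decided under a double negation.
  maximal : ∀ {F} (ax : CkAxioms k ⟦ F ⟧) → (∀ {G} → G ∈ sublists (allESets n) → CkAxioms k ⟦ G ⟧ → F ⊑ G → G ⊑ F) →
    ∀ M′ → IsCkMatroid k M′ → toMatroid ax ≼ M′ → M′ ≼ toMatroid ax
  maximal {F} ax max M′ ck′ F≼M′ A i = decidable-stable (⟦⟧? F A) λ A∉F → ¬¬-decide {P = Indep M′} (allESets n) λ ds →
    let ext = Indep-ext M′
        I′? : ∀ A → Dec (Indep M′ A)
        I′? A = let B , B∈ , eq = find (∈-allESets A) in
                map′ (ext (≐-sym eq)) (ext eq) (All.lookup ds B∈)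
    in A∉F (max (filter-∈-sublists I′? (allESets n))
         (CkAxioms-resp (family⁺ ext I′?) (family⁻ ext I′?) (fromMatroid {M = M′} ck′))
         (λ B → family⁺ ext I′? B ∘ F≼M′ B) A (family⁺ ext I′? A i))

  conclude : (∃[ F ] (CkAxioms k ⟦ F ⟧ × family (Indep-ext M) I? ⊑ F ×
               (∀ {G} → G ∈ sublists (allESets n) → CkAxioms k ⟦ G ⟧ → F ⊑ G → G ⊑ F))) →
    Σ (Matroid n) λ N → IsMaximalCkMatroid k N × M ≼ N
  conclude (F , ax , M⊑F , max) = toMatroid ax , (circ-ax ax , maximal ax max) , λ A → M⊑F A ∘ family⁺ (Indep-ext M) I? A

-- The two matroids

vertices : ∀ {m} → m ≤ n → List (Fin n)
vertices m≤n = tabulate λ i → inject≤ i m≤n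

vertices-unique : ∀ {m} (m≤n : m ≤ n) → Unique (vertices m≤n)
vertices-unique m≤n = UniqueP.tabulate⁺ (FP.inject≤-injective m≤n m≤n _ _)

paving-maximal : ∀ p → 5 + p ≤ n → IsMaximalCkMatroid (5 + p) (paving n (2 + p))
paving-maximal {n} p k≤n = paving-IsCk n (2 + p) , λ M ck above A i →
  card-bounded M ck above (vertices-unique k≤n) (length-tabulate _) A i , λ c → proj₁ (ck A c) i

graphic-path : ∀ {m} (m≤n : m ≤ n) → Indep (graphic n) (pathSet (vertices m≤n))
graphic-path m≤n (D , D⊆ , ev , e , e∈) = pathSet-acyclic {D = D} (vertices m≤n) (vertices-unique m≤n) D⊆ ev e e∈

-- For k = 5 + p this reads k ≤ (k - 1) C 2. It starts from 5 ≤ 6, and by Pascal's rule the right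
-- side grows by 4 + p when the left grows by 1.
5+p≤[4+p]C2 : ∀ p → 5 + p ≤ (4 + p) C 2
5+p≤[4+p]C2 zero    = n≤1+n 5
5+p≤[4+p]C2 (suc p) = begin
  1 + (5 + p)                     ≤⟨ +-mono-≤ (s≤s z≤n) (5+p≤[4+p]C2 p) ⟩
  (4 + p) + (4 + p) C 2           ≡⟨ cong (_+ (4 + p) C 2) (nC1≡n (4 + p)) ⟨
  (4 + p) C 1 + (4 + p) C 2       ≡⟨ nCk+nC[k+1]≡[n+1]C[k+1] (4 + p) 1 ⟩
  (5 + p) C 2                     ∎
  where open ≤-Reasoning

theorem5p2 : (k n : ℕ) → 5 ≤ k → ((k ∸ 1) C 2) + 2 ≤ n →
    Σ (Matroid n) λ M₁ → Σ (Matroid n) λ M₂ →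
    IsMaximalCkMatroid k M₁ × IsMaximalCkMatroid k M₂ × ¬ SameMatroid M₁ M₂
theorem5p2 (suc (suc (suc (suc (suc p))))) n (s≤s (s≤s (s≤s (s≤s (s≤s z≤n))))) h =
  distinct (maximalAbove (graphic n) (λ A → ¬? (hasEven? A)) (graphic-IsCk n (2 + p)))
  where
  k+2≤n : 7 + p ≤ n
  k+2≤n = ≤-trans (≤-reflexive (+-comm 2 (5 + p))) (≤-trans (+-monoˡ-≤ 2 (5+p≤[4+p]C2 p)) h)
  -- A path on k + 2 vertices has k + 1 edges: it is independent in the graphic matroid, hence in
  -- `N`, but one edge too large for the sparse paving matroid.
  path : ESet n
  path = pathSet (vertices k+2≤n)
  card-path : card path ≡ 6 + p
  card-path = trans (card-pathSet _ _ (vertices-unique k+2≤n)) (length-tabulate λ i → inject≤ (suc i) k+2≤n)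
  distinct : (Σ (Matroid n) λ N → IsMaximalCkMatroid (5 + p) N × graphic n ≼ N) →
    Σ (Matroid n) λ M₁ → Σ (Matroid n) λ M₂ →
    IsMaximalCkMatroid (5 + p) M₁ × IsMaximalCkMatroid (5 + p) M₂ × ¬ SameMatroid M₁ M₂
  distinct (N , N-max , above) =
    N , paving n (2 + p) , N-max , paving-maximal p (≤-trans (m≤n+m (5 + p) 2) k+2≤n) , λ same →
      <⇒≱ (≤-reflexive (sym card-path)) (proj₁ (Equivalence.to (same path) (above path (graphic-path k+2≤n))))
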